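{- Let $\Gamma$ be a connected cubic girth-regular graph of girth $4$. Then $\Gamma$ is isomorphic to one of the following: (a) the Möbius ladder $M_n$ for some $n\ge 3$; (b) the prism $Y_n$ for some $n\ge 4$; (c) $\mathrm{Tr}(\Lambda,\leftrightarrow)$ for some tetravalent graph $\Lambda$ (possibly with parallel edges) and some dihedral scheme $\leftrightarrow$ on $\Lambda$.
   Context: $\Gamma$ is a finite simple graph; cubic means $3$-regular. For a graph of finite girth $g$, a girth cycle is a cycle of length $g$, and $\epsilon(e)$ is the number of girth cycles containing the edge $e$. The signature of a vertex $v$ with incident edges $e_1,\ldots,e_k$ ordered so that $\epsilon(e_1)\le\cdots\le\epsilon(e_k)$ is $(\epsilon(e_1),\ldots,\epsilon(e_k))$; a graph is girth-regular if all vertices have the same signature. For $n\ge3$, $M_n=\mathrm{Cay}(\mathbb{Z}_{2n},\{ -1,1,n\})$ and $Y_n=C_n\,\square\,K_2$. A graph with parallel edges and loops is $(V,E,\partial)$ with $\partial:E\to\{X\subseteq V:|X|\le2\}$; each edge consists of two mutually inverse arcs with tails; $\mathrm{out}(u)$ is the set of arcs with tail $u$, and tetravalent means $|\mathrm{out}(u)|=4$ for all $u$. A dihedral scheme on $\Lambda$ is an irreflexive symmetric relation $\leftrightarrow$ on the arc set such that (arcs, $\leftrightarrow$) is a $2$-regular simple graph whose components are exactly the sets $\mathrm{out}(u)$. $\mathrm{Tr}(\Lambda,\leftrightarrow)$ is the simple graph on the arcs of $\Lambda$ with $s,t$ adjacent iff $s\leftrightarrow t$ or $s,t$ are mutually inverse.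 -}

module Defs where

open import Data.Nat using (ℕ; zero; suc; _+_; _≤_)
open import Data.Nat.DivMod using (_%_)
open import Data.Fin using (Fin; toℕ) renaming (_≟_ to _≟ᶠ_)
open import Data.Fin.Base using ()
open import Data.Bool using (Bool; true; false; _∧_; _∨_; not) renaming (_≟_ to _≟ᵇ_)
open import Data.List using (List; []; _∷_; length; filter; map; concatMap; allFin; last)
open import Data.List.Relation.Binary.Permutation.Propositional using (_↭_)
open import Data.Maybe using (just; nothing)
open import Data.Product using (Σ; _×_; _,_)
open import Data.Sum using (_⊎_)
open import Data.Empty using (⊥)
open import Relation.Nullary using (¬_)
open import Relation.Nullary.Decidable using (⌊_⌋)
open import Relation.Binary.PropositionalEquality using (_≡_)
open import Relation.Binary.Construct.Closure.ReflexiveTransitive using (Star)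
open import Function.Bundles using (_↔_; _⇔_; Inverse)

record SimpleGraph : Set where
  field
    n       : ℕ
    adj     : Fin n → Fin n → Bool
    adj-sym : ∀ u v → adj u v ≡ adj v u
    adj-irr : ∀ u → adj u u ≡ false

module _ (Γ : SimpleGraph) where
  open SimpleGraph Γ

  neighbours : Fin n → List (Fin n)
  neighbours u = filter (λ w → adj u w ≟ᵇ true) (allFin n)

  Cubic : Set
  Cubic = ∀ u → length (neighbours u) ≡ 3

  Connected : Set
  Connected = ∀ u v → Star (λ x y → adj x y ≡ true) u v

  elemᵇ : Fin n → List (Fin n) → Bool
  elemᵇ x [] = false
  elemᵇ x (y ∷ ys) = ⌊ x ≟ᶠ y ⌋ ∨ elemᵇ x ys

  nodupᵇ : List (Fin n) → Bool
  nodupᵇ [] = true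
  nodupᵇ (x ∷ xs) = not (elemᵇ x xs) ∧ nodupᵇ xs

  pathᵇ : List (Fin n) → Bool
  pathᵇ [] = true
  pathᵇ (x ∷ []) = true
  pathᵇ (x ∷ y ∷ ys) = adj x y ∧ pathᵇ (y ∷ ys)

  lengthAtLeast3 : List (Fin n) → Bool
  lengthAtLeast3 (_ ∷ _ ∷ _ ∷ _) = true
  lengthAtLeast3 _ = false

  closingᵇ : List (Fin n) → Bool
  closingᵇ [] = false
  closingᵇ (x ∷ xs) with last (x ∷ xs)
  ... | just y  = adj y x
  ... | nothing = false

  isCycle : List (Fin n) → Bool
  isCycle xs = lengthAtLeast3 xs ∧ nodupᵇ xs ∧ pathᵇ xs ∧ closingᵇ xs

  IsGirth : ℕ → Set
  IsGirth g = (Σ (List (Fin n)) λ xs → length xs ≡ g × isCycle xs ≡ true)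
            × (∀ xs → isCycle xs ≡ true → g ≤ length xs)

  allLists : ℕ → List (List (Fin n))
  allLists zero = [] ∷ []
  allLists (suc k) = concatMap (λ x → map (x ∷_) (allLists k)) (allFin n)

  -- ε(uv) for girth g ≥ 3: each g-cycle through edge uv corresponds to exactly
  -- one cyclic sequence u, v, x₂, …, x_{g-1}.
  ε : ℕ → Fin n → Fin n → ℕ
  ε (suc (suc k)) u v =
    length (filter (λ xs → isCycle xs ≟ᵇ true) (map (λ r → u ∷ v ∷ r) (allLists k)))
  ε _ _ _ = 0

  signature : ℕ → Fin n → List ℕ
  signature g u = map (ε g u) (neighbours u)

  GirthRegular : ℕ → Set
  GirthRegular g = ∀ u v → signature g u ↭ signature g v

  _≅_ : (Σ Set λ W → (W → W → Set)) → Set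
  _≅_ (W , R) = Σ (Fin n ↔ W) λ φ →
    ∀ u v → (adj u v ≡ true) ⇔ R (Inverse.to φ u) (Inverse.to φ v)

-- Möbius ladder M_n = Cay(ℤ_{2n}, {-1, 1, n}) on Fin (n + n)

MöbiusAdj : (n : ℕ) → Fin (n + n) → Fin (n + n) → Set
MöbiusAdj zero _ _ = ⊥
MöbiusAdj (suc m) i j =
  toℕ j ≡ (toℕ i + 1) % (suc m + suc m)
  ⊎ toℕ i ≡ (toℕ j + 1) % (suc m + suc m)
  ⊎ toℕ j ≡ (toℕ i + suc m) % (suc m + suc m)

Möbius : ℕ → Σ Set λ W → (W → W → Set)
Möbius n = Fin (n + n) , MöbiusAdj n

CycleAdj : (m : ℕ) → Fin m → Fin m → Set
CycleAdj zero _ _ = ⊥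
CycleAdj (suc k) i j = toℕ j ≡ (toℕ i + 1) % suc k ⊎ toℕ i ≡ (toℕ j + 1) % suc k

-- prism Y_m = C_m □ K_2 on Fin m × Bool
PrismAdj : (m : ℕ) → Fin m × Bool → Fin m × Bool → Set
PrismAdj m (i , a) (j , b) = (a ≡ b × CycleAdj m i j) ⊎ (i ≡ j × ¬ (a ≡ b))

Prism : ℕ → Σ Set λ W → (W → W → Set)
Prism m = (Fin m × Bool) , PrismAdj m

-- Graphs with parallel edges and loops: vertices Fin nV, edges Fin nE;
-- edge e has two mutually inverse arcs (e , true), (e , false) with tails
-- ends e true, ends e false; ∂ e = {ends e true , ends e false}.

record MultiGraph : Set where
  field
    nV   : ℕ
    nE   : ℕ
    ends : Fin nE → Bool → Fin nV

  Arc : Set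
  Arc = Fin nE × Bool

  tail : Arc → Fin nV
  tail (e , b) = ends e b

  inv : Arc → Arc
  inv (e , b) = (e , not b)

  arcs : List Arc
  arcs = concatMap (λ e → (e , true) ∷ (e , false) ∷ []) (allFin nE)

  out : Fin nV → List Arc
  out u = filter (λ a → tail a ≟ᶠ u) arcs

  Tetravalent : Set
  Tetravalent = ∀ u → length (out u) ≡ 4

  _≟ᵃ_ : Arc → Arc → Bool
  (e , b) ≟ᵃ (f , c) = ⌊ e ≟ᶠ f ⌋ ∧ ⌊ b ≟ᵇ c ⌋

  record DihedralScheme : Set where
    field
      rel     : Arc → Arc → Bool
      rel-sym : ∀ s t → rel s t ≡ rel t s
      rel-irr : ∀ s → rel s s ≡ false
      two-reg : ∀ s → length (filter (λ t → rel s t ≟ᵇ true) arcs) ≡ 2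
      components : ∀ s t → Star (λ a b → rel a b ≡ true) s t ⇔ (tail s ≡ tail t)

  Tr : DihedralScheme → Σ Set λ W → (W → W → Set)
  Tr D = Arc , λ s t → DihedralScheme.rel D s t ≡ true ⊎ inv s ≡ t

{-# OPTIONS --safe #-}
-- For distinct neighbours x, y of a vertex u let c(x, y) be the number of common neighbours of
-- x and y other than u.  The signature of u sums to twice the sum k of c over the three pairs of
-- neighbours, so the number k ≥ 1 of 4-cycles through a vertex is the same everywhere.
--   * If some c(x, y) ≥ 2, then Γ contains K₂,₃; this forces k ≥ 3, and then Γ = K₃,₃ = M₃.
--   * Otherwise k ≤ 3.  If k = 3, every 2-path lies in a square and Γ is the cube Y₄.
--   * If k = 2, each vertex has one edge lying in two squares; these rungs form a perfect matching
--     ρ preserving the other edges.  A walk along the other edges closes up first at its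
--     starting point (prism) or at the other end of the starting rung (Möbius ladder).
--   * If k = 1, the squares partition the vertices and the edges outside squares form a perfect
--     matching; contracting the squares gives Λ, whose arcs are the vertices of Γ.
module Submission where

open import Defs
open import Data.Bool using (Bool; true; false; _∧_; not; _xor_) renaming (_≟_ to _≟ᵇ_)
open import Data.Empty using (⊥; ⊥-elim)
open import Data.Fin using (Fin; zero; suc; toℕ) renaming (_≟_ to _≟ᶠ_)
open import Data.Fin.Patterns
open import Data.Fin.Properties using (injective⇒≤; toℕ<n; toℕ-injective; toℕ-fromℕ<; pigeonhole; any?)
open import Data.List using (List; []; _∷_; length; filter; allFin; lookup; map; concatMap; cartesianProduct; _++_; cartesianProductWith)
open import Data.List.Membership.Propositional using (_∈_)
open import Data.List.Membership.Propositional.Properties using (∈-filter⁺; ∈-filter⁻; ∈-allFin; ∈-lookup; ∈-map⁺; ∈-map⁻; ∈-cartesianProduct⁺; ∈-cartesianProductWith⁺; ∈-cartesianProductWith⁻; ∈-++⁺ˡ; ∈-++⁺ʳ; ∈-++⁻)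
open import Data.List.Membership.Propositional.Properties.WithK using (unique∧set⇒bag)
open import Data.List.Properties using (length-map; filter-≐; length-++; ∷-injective; ∷-injectiveˡ; ∷-injectiveʳ)
open import Data.List.Relation.Binary.BagAndSetEquality using (∼bag⇒↭)
open import Data.List.Relation.Binary.Permutation.Propositional using (_↭_)
open import Data.List.Relation.Binary.Permutation.Propositional.Properties using (↭-length) renaming (map⁺ to ↭-map⁺)
open import Data.List.Relation.Unary.All using (All; []; _∷_)
import Data.List.Relation.Unary.All as All
open import Data.List.Relation.Unary.AllPairs using ([]; _∷_)
open import Data.List.Relation.Unary.Any using (here; there; index)
open import Data.List.Relation.Unary.Any.Properties using (lookup-index)
open import Data.List.Relation.Unary.Unique.Propositional using (Unique)
open import Data.List.Relation.Unary.Unique.Propositional.Properties using (allFin⁺; filter⁺; map⁺; cartesianProduct⁺; cartesianProductWith⁺; ++⁺)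
open import Data.Nat using (ℕ; suc; _≤_; zero; _+_; _*_; _<_; z≤n; s≤s; NonZero; _<?_; _≤?_)
open import Data.Nat.DivMod using (_%_; _/_; _mod_; m≡m%n+[m/n]*n; m%n<n; m<n⇒m%n≡m; m%n%n≡m%n; [m+n]%n≡m%n; %-distribˡ-+)
open import Data.Nat.ListAction using (sum)
open import Data.Nat.ListAction.Properties using (sum-↭)
open import Data.Nat.Properties using (1+n≰n; ≤-reflexive; ≤-trans; +-assoc; +-comm; +-suc; +-cancelˡ-<; n<1+n; <-cmp; m≤n⇒∃[o]m+o≡n; m≤m+n; ≤-<-trans; ≤-pred; +-identityʳ; <-asym; *-cancelˡ-≡; +-mono-≤; ≰⇒>)
open import Data.Nat.Solver using (module +-*-Solver)
open import Data.Product using (Σ; _×_; _,_; proj₁; proj₂; ∃-syntax; swap; map₂)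
open import Data.Sum using (_⊎_; inj₁; inj₂; assocʳ)
open import Function using (_∘_)
open import Function.Bundles using (mk⇔; mk↔ₛ′)
open import Relation.Binary using (tri<; tri≈; tri>)
open import Relation.Binary.Construct.Closure.ReflexiveTransitive using (Star; _◅_; _◅◅_; gmap; reverse) renaming (ε to done)
open import Relation.Binary.PropositionalEquality using (_≡_; _≢_; refl; sym; trans; cong; subst; ≢-sym; cong₂; subst₂; module ≡-Reasoning)
open import Relation.Nullary using (¬_; yes; no; contradiction; Dec)
open import Relation.Nullary.Decidable using (_⊎-dec_; ⌊_⌋; _×-dec_; ¬?)
open import Relation.Unary using (Decidable)

-- Lists without repetition.

module _ {A : Set} where

  lookup-injective : {xs : List A} → Unique xs → ∀ {i j} → lookup xs i ≡ lookup xs j → i ≡ j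
  lookup-injective (_ ∷ _)  {zero}  {zero}  _  = refl
  lookup-injective (p ∷ _)  {zero}  {suc j} eq = contradiction eq (All.lookup p (∈-lookup j))
  lookup-injective (p ∷ _)  {suc i} {zero}  eq = contradiction (sym eq) (All.lookup p (∈-lookup i))
  lookup-injective (_ ∷ ps) {suc i} {suc j} eq = cong suc (lookup-injective ps eq)

  -- Sending each position of `xs` to the position of its entry in `ys` is an injection between
  -- finite sets.
  unique-⊆⇒length≤ : {xs ys : List A} → Unique xs → (∀ {z} → z ∈ xs → z ∈ ys) → length xs ≤ length ys
  unique-⊆⇒length≤ {xs} {ys} uniq sub = injective⇒≤ {f = index ∘ mem} λ {i} {j} eq →
    lookup-injective uniq (trans (lookup-index (mem i)) (trans (cong (lookup ys) eq) (sym (lookup-index (mem j)))))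
    where
    mem : ∀ i → lookup xs i ∈ ys
    mem i = sub (∈-lookup i)

  -- Without repetitions equality as sets is equality as bags. All later counts are made by
  -- exhibiting an explicit list and comparing members.
  unique-set⇒↭ : {xs ys : List A} → Unique xs → Unique ys →
    (∀ {z} → z ∈ xs → z ∈ ys) → (∀ {z} → z ∈ ys → z ∈ xs) → xs ↭ ys
  unique-set⇒↭ uxs uys to from = ∼bag⇒↭ (unique∧set⇒bag uxs uys (mk⇔ to from))

-- Adjacency and neighbourhoods, first in general and then in cubic graphs.

module Graph (Γ : SimpleGraph) where
  open SimpleGraph Γ public using (n; adj)
  open SimpleGraph Γ using (adj-sym; adj-irr)

  infix 4 _∼_
  _∼_ : Fin n → Fin n → Set
  u ∼ v = adj u v ≡ true

  ∼-sym : ∀ {u v} → u ∼ v → v ∼ u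
  ∼-sym {u} {v} e = trans (adj-sym v u) e

  ∼⇒≢ : ∀ {u v} → u ∼ v → u ≢ v
  ∼⇒≢ {u} e refl with () ← trans (sym e) (adj-irr u)

  -- In a cubic graph these are all the neighbours of `u`, in a chosen order; arguments symmetric in
  -- them are transported by `rotate` and the swaps.
  record Nbrs (u a b c : Fin n) : Set where
    constructor mkNbrs
    field
      ∼₁  : u ∼ a
      ∼₂  : u ∼ b
      ∼₃  : u ∼ c
      ≢₁₂ : a ≢ b
      ≢₁₃ : a ≢ c
      ≢₂₃ : b ≢ c

  open Nbrs public

  rotate : ∀ {u a b c} → Nbrs u a b c → Nbrs u b c a
  rotate (mkNbrs p q r ab ac bc) = mkNbrs q r p bc (≢-sym ab) (≢-sym ac)

  swap₂₃ : ∀ {u a b c} → Nbrs u a b c → Nbrs u a c b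
  swap₂₃ (mkNbrs p q r ab ac bc) = mkNbrs p r q ac ab (≢-sym bc)

  swap₁₂ : ∀ {u a b c} → Nbrs u a b c → Nbrs u b a c
  swap₁₂ (mkNbrs p q r ab ac bc) = mkNbrs q p r (≢-sym ab) bc ac

  ∈-neighbours⁺ : ∀ {u w} → u ∼ w → w ∈ neighbours Γ u
  ∈-neighbours⁺ {u} {w} e = ∈-filter⁺ (λ w → adj u w ≟ᵇ true) (∈-allFin w) e

  ∈-neighbours⁻ : ∀ {u w} → w ∈ neighbours Γ u → u ∼ w
  ∈-neighbours⁻ {u} m = proj₂ (∈-filter⁻ (λ w → adj u w ≟ᵇ true) {xs = allFin n} m)

  neighbours-unique : ∀ u → Unique (neighbours Γ u)
  neighbours-unique u = filter⁺ (λ w → adj u w ≟ᵇ true) (allFin⁺ n)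

  TriangleFree : Set
  TriangleFree = ∀ {u v w} → u ∼ v → v ∼ w → u ∼ w → ⊥

module CubicGraph (Γ : SimpleGraph) (cubic : Cubic Γ) where
  open Graph Γ public

  nbrs : ∀ u → ∃[ a ] ∃[ b ] ∃[ c ] Nbrs u a b c
  nbrs u with neighbours Γ u in eq | cubic u
  ... | a ∷ b ∷ c ∷ [] | refl with subst Unique eq (neighbours-unique u)
  ... | (ab ∷ ac ∷ []) ∷ (bc ∷ []) ∷ [] ∷ [] =
    a , b , c , mkNbrs (adjacent (here refl)) (adjacent (there (here refl)))
                       (adjacent (there (there (here refl)))) ab ac bc
    where
    adjacent : ∀ {w} → w ∈ a ∷ b ∷ c ∷ [] → u ∼ w
    adjacent m = ∈-neighbours⁻ (subst (_ ∈_) (sym eq) m)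

  module _ {u a b c} (N : Nbrs u a b c) where

    -- A fourth neighbour would give four distinct entries in a neighbour list of length 3.
    complete : ∀ {w} → u ∼ w → w ≡ a ⊎ w ≡ b ⊎ w ≡ c
    complete {w} uw with w ≟ᶠ a | w ≟ᶠ b | w ≟ᶠ c
    ... | yes e | _     | _     = inj₁ e
    ... | no _  | yes e | _     = inj₂ (inj₁ e)
    ... | no _  | no _  | yes e = inj₂ (inj₂ e)
    ... | no wa | no wb | no wc = contradiction
      (≤-trans (unique-⊆⇒length≤ uniq sub) (≤-reflexive (cubic u))) 1+n≰n
      where
      uniq : Unique (w ∷ a ∷ b ∷ c ∷ [])
      uniq = (wa ∷ wb ∷ wc ∷ []) ∷ (≢₁₂ N ∷ ≢₁₃ N ∷ []) ∷ (≢₂₃ N ∷ []) ∷ [] ∷ []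
      sub : ∀ {z} → z ∈ w ∷ a ∷ b ∷ c ∷ [] → z ∈ neighbours Γ u
      sub (here refl) = ∈-neighbours⁺ uw
      sub (there (here refl)) = ∈-neighbours⁺ (∼₁ N)
      sub (there (there (here refl))) = ∈-neighbours⁺ (∼₂ N)
      sub (there (there (there (here refl)))) = ∈-neighbours⁺ (∼₃ N)

    remaining : ∀ {w} → u ∼ w → w ≢ a → w ≢ b → w ≡ c
    remaining uw wa wb with complete uw
    ... | inj₁ e = contradiction e wa
    ... | inj₂ (inj₁ e) = contradiction e wb
    ... | inj₂ (inj₂ e) = e

    neighbours-↭ : neighbours Γ u ↭ a ∷ b ∷ c ∷ []
    neighbours-↭ = unique-set⇒↭ (neighbours-unique u)
      ((≢₁₂ N ∷ ≢₁₃ N ∷ []) ∷ (≢₂₃ N ∷ []) ∷ [] ∷ []) to from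
      where
      to : ∀ {z} → z ∈ neighbours Γ u → z ∈ a ∷ b ∷ c ∷ []
      to m with complete (∈-neighbours⁻ m)
      ... | inj₁ e = here e
      ... | inj₂ (inj₁ e) = there (here e)
      ... | inj₂ (inj₂ e) = there (there (here e))
      from : ∀ {z} → z ∈ a ∷ b ∷ c ∷ [] → z ∈ neighbours Γ u
      from (here refl) = ∈-neighbours⁺ (∼₁ N)
      from (there (here refl)) = ∈-neighbours⁺ (∼₂ N)
      from (there (there (here refl))) = ∈-neighbours⁺ (∼₃ N)

  others : ∀ {u a} → u ∼ a → ∃[ b ] ∃[ c ] Nbrs u a b c
  others {u} ua with nbrs u
  ... | x , y , z , N with complete N ua
  ... | inj₁ refl = y , z , N
  ... | inj₂ (inj₁ refl) = z , x , rotate N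
  ... | inj₂ (inj₂ refl) = x , y , rotate (rotate N)

  third : ∀ {u a b} → u ∼ a → u ∼ b → a ≢ b → ∃[ c ] Nbrs u a b c
  third ua ub ab with others ua
  ... | x , y , N with complete N ub
  ... | inj₁ e = contradiction (sym e) ab
  ... | inj₂ (inj₁ refl) = y , N
  ... | inj₂ (inj₂ refl) = x , swap₂₃ N

-- Least witnesses, periodic sequences and residues.

-- Upward search from 0; the known witness `d` bounds the recursion.
least : {P : ℕ → Set} → Decidable P → ∀ d → P d → ∃[ m ] P m × (∀ {j} → j < m → ¬ P j)
least P? d p with P? 0
least P? d p       | yes p₀ = 0 , p₀ , λ ()
least P? zero p    | no ¬p₀ = contradiction p ¬p₀
least P? (suc d) p | no ¬p₀ with least (P? ∘ suc) d p
... | m , pm , min = suc m , pm , λ { {zero} _ → ¬p₀ ; {suc j} (s≤s j<m) → min j<m }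

<⇒∃ : ∀ {i j} → i < j → ∃[ d ] j ≡ suc d + i
<⇒∃ {i} i<j with m≤n⇒∃[o]m+o≡n i<j
... | d , eq = d , trans (sym eq) (cong suc (+-comm i d))

module _ {A : Set} (a : ℕ → A) (N : ℕ) .{{_ : NonZero N}} (period : ∀ i → a (N + i) ≡ a i) where

  periodic-* : ∀ q i → a (q * N + i) ≡ a i
  periodic-* zero    i = refl
  periodic-* (suc q) i = trans (cong a (+-assoc N (q * N) i)) (trans (period _) (periodic-* q i))

  periodic-% : ∀ i → a (i % N) ≡ a i
  periodic-% i = trans (sym (periodic-* (i / N) (i % N)))
    (cong a (trans (+-comm (i / N * N) (i % N)) (sym (m≡m%n+[m/n]*n i N))))

  periodic-mod : ∀ i → a (toℕ (i mod N)) ≡ a i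
  periodic-mod i = trans (cong a (toℕ-fromℕ< (m%n<n i N))) (periodic-% i)

toℕ-mod : ∀ i N .{{_ : NonZero N}} → toℕ (i mod N) ≡ i % N
toℕ-mod i N = toℕ-fromℕ< (m%n<n i N)

%-+1 : ∀ x N .{{_ : NonZero N}} → (x % N + 1) % N ≡ (x + 1) % N
%-+1 x N = trans (%-distribˡ-+ (x % N) 1 N)
  (trans (cong (λ y → (y + 1 % N) % N) (m%n%n≡m%n x N)) (sym (%-distribˡ-+ x 1 N)))

-- Modulo `suc k`, adding `k` is subtracting 1, which gives the cyclic predecessor without truncated
-- subtraction.
mod-pred : ∀ {k} (i : Fin (suc k)) → toℕ i ≡ (toℕ ((toℕ i + k) mod suc k) + 1) % suc k
mod-pred {k} i = sym (begin
  (toℕ ((toℕ i + k) mod suc k) + 1) % suc k ≡⟨ cong (λ y → (y + 1) % suc k) (toℕ-mod (toℕ i + k) (suc k)) ⟩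
  ((toℕ i + k) % suc k + 1) % suc k         ≡⟨ %-+1 (toℕ i + k) (suc k) ⟩
  (toℕ i + k + 1) % suc k                   ≡⟨ cong (_% suc k) (trans (+-assoc (toℕ i) k 1) (cong (toℕ i +_) (+-comm k 1))) ⟩
  (toℕ i + suc k) % suc k                   ≡⟨ [m+n]%n≡m%n (toℕ i) (suc k) ⟩
  toℕ i % suc k                             ≡⟨ m<n⇒m%n≡m (toℕ<n i) ⟩
  toℕ i                                     ∎)
  where open ≡-Reasoning

-- Recognising prisms and Möbius ladders from periodic sequences.

module Recognition (Γ : SimpleGraph) (connected : Connected Γ) (cubic : Cubic Γ) where
  open CubicGraph Γ cubic

  -- The images of the three given `R`-neighbours of `w` exhaust the neighbours of `F w`, so edges
  -- and then paths lift along `F`. Connectedness makes `F` surjective, and lifting an edge shows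
  -- that `F` reflects adjacency.
  cubic-≅ : {W : Set} {R : W → W → Set} (F : W → Fin n) → W →
    (∀ {w w′} → F w ≡ F w′ → w ≡ w′) →
    (∀ {w w′} → R w w′ → F w ∼ F w′) →
    (∀ w → ∃[ a ] ∃[ b ] ∃[ c ] (R w a × R w b × R w c × F a ≢ F b × F a ≢ F c × F b ≢ F c)) →
    _≅_ Γ (W , R)
  cubic-≅ {W} {R} F w₀ inj hom three =
    mk↔ₛ′ from F (λ w → inj (F∘from (F w))) F∘from ,
    λ u v → mk⇔ (reflects u v) (λ r → subst₂ _∼_ (F∘from u) (F∘from v) (hom r))
    where
    lift : ∀ w {v} → F w ∼ v → ∃[ w′ ] R w w′ × F w′ ≡ v
    lift w e with three w
    ... | a , b , c , ra , rb , rc , ab , ac , bc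
      with complete (mkNbrs (hom ra) (hom rb) (hom rc) ab ac bc) e
    ... | inj₁ eq = a , ra , sym eq
    ... | inj₂ (inj₁ eq) = b , rb , sym eq
    ... | inj₂ (inj₂ eq) = c , rc , sym eq

    reach : ∀ w {u v} → F w ≡ u → Star _∼_ u v → ∃[ w′ ] F w′ ≡ v
    reach w eq done = w , eq
    reach w refl (e ◅ s) with lift w e
    ... | w′ , _ , eq = reach w′ eq s

    from : Fin n → W
    from v = proj₁ (reach w₀ refl (connected (F w₀) v))

    F∘from : ∀ v → F (from v) ≡ v
    F∘from v = proj₂ (reach w₀ refl (connected (F w₀) v))

    reflects : ∀ u v → u ∼ v → R (from u) (from v)
    reflects u v e with lift (from u) (subst (_∼ v) (sym (F∘from u)) e)
    ... | w , r , eq = subst (R (from u)) (inj (trans eq (sym (F∘from v)))) r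

  -- The two rails are infinite periodic sequences, so the hypotheses involve no residues;
  -- injectivity is asked on one period only.
  prism-≅ : ∀ k (a : Bool → ℕ → Fin n) →
    (∀ s i → a s (suc k + i) ≡ a s i) →
    (∀ s i → a s i ∼ a s (suc i)) →
    (∀ i → a true i ∼ a false i) →
    (∀ s i → a s i ≢ a s (2 + i)) →
    (∀ {s t i j} → i < suc k → j < suc k → a s i ≡ a t j → s ≡ t × i ≡ j) →
    _≅_ Γ (Prism (suc k))
  prism-≅ k a period step rung noBack inj = cubic-≅ F (zero , true) F-inj hom three
    where
    N = suc k

    F : Fin N × Bool → Fin n
    F (i , s) = a s (toℕ i)

    F-inj : ∀ {w w′} → F w ≡ F w′ → w ≡ w′
    F-inj {i , s} {j , t} eq with inj {s} {t} (toℕ<n i) (toℕ<n j) eq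
    ... | st , ij = cong₂ _,_ (toℕ-injective ij) st

    next : ∀ s (i : Fin N) {j} → j ≡ (toℕ i + 1) % N → a s j ≡ a s (suc (toℕ i))
    next s i refl = trans (periodic-% (a s) N (period s) (toℕ i + 1)) (cong (a s) (+-comm (toℕ i) 1))

    hom : ∀ {w w′} → PrismAdj N w w′ → F w ∼ F w′
    hom {i , s} {j , .s} (inj₁ (refl , inj₁ e)) = subst (a s (toℕ i) ∼_) (sym (next s i e)) (step s _)
    hom {i , s} {j , .s} (inj₁ (refl , inj₂ e)) =
      ∼-sym (subst (a s (toℕ j) ∼_) (sym (next s j e)) (step s _))
    hom {i , true}  {.i , true}  (inj₂ (refl , st)) = contradiction refl st
    hom {i , true}  {.i , false} (inj₂ (refl , st)) = rung _
    hom {i , false} {.i , true}  (inj₂ (refl , st)) = ∼-sym (rung _)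
    hom {i , false} {.i , false} (inj₂ (refl , st)) = contradiction refl st

    not-≢ : ∀ s → s ≢ not s
    not-≢ true ()
    not-≢ false ()

    three : ∀ w → ∃[ a ] ∃[ b ] ∃[ c ]
      (PrismAdj N w a × PrismAdj N w b × PrismAdj N w c × F a ≢ F b × F a ≢ F c × F b ≢ F c)
    three (i , s) = (i⁺ , s) , (i⁻ , s) , (i , not s) ,
      inj₁ (refl , inj₁ (toℕ-mod (toℕ i + 1) N)) , inj₁ (refl , inj₂ (mod-pred i)) , inj₂ (refl , not-≢ s) ,
      (λ eq → noBack s (toℕ i + k) (trans (sym F⁻) (trans (sym eq) F⁺))) ,
      (λ eq → not-≢ s (proj₁ (inj (toℕ<n i⁺) (toℕ<n i) eq))) ,
      (λ eq → not-≢ s (proj₁ (inj (toℕ<n i⁻) (toℕ<n i) eq)))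
      where
      i⁺ i⁻ : Fin N
      i⁺ = (toℕ i + 1) mod N
      i⁻ = (toℕ i + k) mod N
      F⁻ : F (i⁻ , s) ≡ a s (toℕ i + k)
      F⁻ = periodic-mod (a s) N (period s) _
      -- The successor is read one period later, which places it two steps after the predecessor,
      -- where `noBack` applies.
      F⁺ : F (i⁺ , s) ≡ a s (2 + (toℕ i + k))
      F⁺ = trans (next s i (toℕ-mod (toℕ i + 1) N)) (trans (sym (period s _))
        (cong (a s ∘ suc) (trans (+-suc k (toℕ i)) (cong suc (+-comm k (toℕ i))))))

  -- The sequence runs around the rim of length `M + M`, and rungs join places `M` apart. The three
  -- inequalities before `inj` keep successor, predecessor and opposite vertex distinct.
  möbius-≅ : ∀ k (a : ℕ → Fin n) → let M = suc k in
    (∀ i → a (M + M + i) ≡ a i) →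
    (∀ i → a i ∼ a (suc i)) →
    (∀ i → a i ∼ a (M + i)) →
    (∀ i → a i ≢ a (2 + i)) →
    (∀ i → a (suc i) ≢ a (M + i)) →
    (∀ i → a i ≢ a (M + suc i)) →
    (∀ {i j} → i < M + M → j < M + M → a i ≡ a j → i ≡ j) →
    _≅_ Γ (Möbius M)
  möbius-≅ k a period step rung noBack noRung⁺ noRung⁻ inj = cubic-≅ F zero F-inj hom three
    where
    M = suc k
    -- `suc K` is `M + M` by definition, so `K` acts as minus one modulo the rim length.
    K = k + M
    N = suc K

    F : Fin N → Fin n
    F i = a (toℕ i)

    F-inj : ∀ {w w′} → F w ≡ F w′ → w ≡ w′
    F-inj {i} {j} eq = toℕ-injective (inj (toℕ<n i) (toℕ<n j) eq)

    next : ∀ (i : Fin N) {j} → j ≡ (toℕ i + 1) % N → a j ≡ a (suc (toℕ i))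
    next i refl = trans (periodic-% a N period (toℕ i + 1)) (cong a (+-comm (toℕ i) 1))

    opposite : ∀ (i : Fin N) {j} → j ≡ (toℕ i + M) % N → a j ≡ a (M + toℕ i)
    opposite i refl = trans (periodic-% a N period (toℕ i + M)) (cong a (+-comm (toℕ i) M))

    hom : ∀ {w w′} → MöbiusAdj M w w′ → F w ∼ F w′
    hom {i} {j} (inj₁ e) = subst (a (toℕ i) ∼_) (sym (next i e)) (step _)
    hom {i} {j} (inj₂ (inj₁ e)) = ∼-sym (subst (a (toℕ j) ∼_) (sym (next j e)) (step _))
    hom {i} {j} (inj₂ (inj₂ e)) = subst (a (toℕ i) ∼_) (sym (opposite i e)) (rung _)

    three : ∀ w → ∃[ a ] ∃[ b ] ∃[ c ]
      (MöbiusAdj M w a × MöbiusAdj M w b × MöbiusAdj M w c × F a ≢ F b × F a ≢ F c × F b ≢ F c)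
    three i = i⁺ , i⁻ , i* ,
      inj₁ (toℕ-mod (toℕ i + 1) N) , inj₂ (inj₁ (mod-pred i)) , inj₂ (inj₂ (toℕ-mod (toℕ i + M) N)) ,
      (λ eq → noBack (toℕ i + K) (trans (sym F⁻) (trans (sym eq) (trans F⁺ wrap)))) ,
      (λ eq → noRung⁺ (toℕ i) (trans (sym F⁺) (trans eq F*))) ,
      (λ eq → noRung⁻ (toℕ i + K) (trans (sym F⁻) (trans eq (trans F* wrap*))))
      where
      i⁺ i⁻ i* : Fin N
      i⁺ = (toℕ i + 1) mod N
      i⁻ = (toℕ i + K) mod N
      i* = (toℕ i + M) mod N
      F⁻ : F i⁻ ≡ a (toℕ i + K)
      F⁻ = periodic-mod a N period _
      F⁺ : F i⁺ ≡ a (suc (toℕ i))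
      F⁺ = next i (toℕ-mod (toℕ i + 1) N)
      F* : F i* ≡ a (M + toℕ i)
      F* = opposite i (toℕ-mod (toℕ i + M) N)
      wrap : a (suc (toℕ i)) ≡ a (2 + (toℕ i + K))
      wrap = trans (sym (period _)) (cong (a ∘ suc) (trans (+-suc K (toℕ i)) (cong suc (+-comm K (toℕ i)))))
      wrap* : a (M + toℕ i) ≡ a (M + suc (toℕ i + K))
      wrap* = trans (sym (period _)) (cong a (begin
        N + (M + toℕ i)       ≡⟨ +-comm N (M + toℕ i) ⟩
        M + toℕ i + N         ≡⟨ +-assoc M (toℕ i) N ⟩
        M + (toℕ i + suc K)   ≡⟨ cong (M +_) (+-suc (toℕ i) K) ⟩
        M + suc (toℕ i + K)   ∎))
        where open ≡-Reasoning

-- Cubic graphs with a rung involution.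

module Ladder (Γ : SimpleGraph) (connected : Connected Γ) (cubic : Cubic Γ) where
  open CubicGraph Γ cubic
  open Recognition Γ connected cubic

  module _ (triangle-free : TriangleFree)
    (ρ : Fin n → Fin n) (ρ-adj : ∀ u → u ∼ ρ u) (ρ-involutive : ∀ u → ρ (ρ u) ≡ u)
    (ρ-pres : ∀ {u v} → u ∼ v → v ≢ ρ u → ρ u ∼ ρ v) where

    ρ-injective : ∀ {u v} → ρ u ≡ ρ v → u ≡ v
    ρ-injective {u} {v} eq = trans (sym (ρ-involutive u)) (trans (cong ρ eq) (ρ-involutive v))

    ρ-flip : ∀ {u v} → u ≡ ρ v → ρ u ≡ v
    ρ-flip eq = trans (cong ρ eq) (ρ-involutive _)

    -- Of the three neighbours of `q`, `p` and the rung mate `ρ q` take two, which leaves one.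
    determined : ∀ {q p t t′} → q ∼ p → p ≢ ρ q →
      q ∼ t → t ≢ p → t ≢ ρ q → q ∼ t′ → t′ ≢ p → t′ ≢ ρ q → t ≡ t′
    determined {q} qp pρ qt tp tρ qt′ tp′ tρ′ with third qp (ρ-adj q) pρ
    ... | _ , N = trans (remaining N qt tp tρ) (sym (remaining N qt′ tp′ tρ′))

    -- A walk along the rails that never reverses. By `determined`, two consecutive vertices fix the
    -- rest of it in both directions.
    record IsWalk (a : ℕ → Fin n) : Set where
      field
        step   : ∀ i → a i ∼ a (suc i)
        noRung : ∀ i → a (suc i) ≢ ρ (a i)
        noBack : ∀ i → a i ≢ a (2 + i)

      noRung′ : ∀ i → a i ≢ ρ (a (suc i))
      noRung′ i eq = noRung i (sym (ρ-flip eq))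

    open IsWalk

    ρ-walk : ∀ {a} → IsWalk a → IsWalk (ρ ∘ a)
    ρ-walk w .step i = ρ-pres (step w i) (noRung w i)
    ρ-walk w .noRung i eq = noRung w i (ρ-injective eq)
    ρ-walk w .noBack i eq = noBack w i (ρ-injective eq)

    module _ {a b : ℕ → Fin n} (A : IsWalk a) (B : IsWalk b) where

      walk-forward : ∀ i j → a i ≡ b j → a (suc i) ≡ b (suc j) → a (2 + i) ≡ b (2 + j)
      walk-forward i j e e′ = determined (∼-sym (step A i)) (noRung′ A i)
        (step A (suc i)) (≢-sym (noBack A i)) (noRung A (suc i))
        (subst (_∼ b (2 + j)) (sym e′) (step B (suc j)))
        (λ eq → noBack B j (trans (sym e) (sym eq)))
        (λ eq → noRung B (suc j) (trans eq (cong ρ e′)))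

      walk-backward : ∀ i j → a (suc i) ≡ b (suc j) → a (2 + i) ≡ b (2 + j) → a i ≡ b j
      walk-backward i j e e′ = determined (step A (suc i)) (noRung A (suc i))
        (∼-sym (step A i)) (noBack A i) (noRung′ A i)
        (subst (_∼ b j) (sym e) (∼-sym (step B j)))
        (λ eq → noBack B j (trans eq e′))
        (λ eq → noRung′ B j (trans eq (cong ρ e)))

      -- The argument of `walk-forward` with the second walk traversed backwards.
      walk-reflect : ∀ i j → a i ≡ b (2 + j) → a (suc i) ≡ b (suc j) → a (2 + i) ≡ b j
      walk-reflect i j e e′ = determined (∼-sym (step A i)) (noRung′ A i)
        (step A (suc i)) (≢-sym (noBack A i)) (noRung A (suc i))
        (subst (_∼ b j) (sym e′) (∼-sym (step B j)))
        (λ eq → noBack B j (trans eq e))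
        (λ eq → noRung′ B j (trans eq (cong ρ e′)))

      -- At the common vertex the only two non-rung neighbours are the vertices just before and just
      -- after it on `b`.
      walk-branch : ∀ i j → a i ≡ b (suc j) → a (suc i) ≡ b (2 + j) ⊎ a (suc i) ≡ b j
      walk-branch i j e with a (suc i) ≟ᶠ b j
      ... | yes eq = inj₂ eq
      ... | no neq = inj₁ (determined (∼-sym (step B j)) (noRung′ B j)
        (subst (_∼ a (suc i)) e (step A i)) neq (λ eq → noRung A i (trans eq (cong ρ (sym e))))
        (step B (suc j)) (≢-sym (noBack B j)) (noRung B (suc j)))

    Arc : Set
    Arc = ∃[ p ] ∃[ q ] (p ∼ q × q ≢ ρ p)

    nextArc : Arc → Arc
    nextArc (p , q , pq , qp) with third (∼-sym pq) (ρ-adj q) (λ eq → qp (sym (ρ-flip eq)))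
    ... | t , N = q , t , ∼₃ N , ≢-sym (≢₂₃ N)

    nextArc-tail : ∀ s → proj₁ (nextArc s) ≡ proj₁ (proj₂ s)
    nextArc-tail (p , q , pq , qp) = refl

    nextArc-head : ∀ s → proj₁ s ≢ proj₁ (proj₂ (nextArc s))
    nextArc-head (p , q , pq , qp) with third (∼-sym pq) (ρ-adj q) (λ eq → qp (sym (ρ-flip eq)))
    ... | t , N = ≢₁₃ N

    arc : Arc → ℕ → Arc
    arc s zero    = s
    arc s (suc i) = nextArc (arc s i)

    walk : Arc → ℕ → Fin n
    walk s i = proj₁ (arc s i)

    walk-isWalk : ∀ s → IsWalk (walk s)
    walk-isWalk s .step i = subst (walk s i ∼_) (sym (nextArc-tail (arc s i))) (proj₁ (proj₂ (proj₂ (arc s i))))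
    walk-isWalk s .noRung i eq = proj₂ (proj₂ (proj₂ (arc s i))) (trans (sym (nextArc-tail (arc s i))) eq)
    walk-isWalk s .noBack i eq = nextArc-head (arc s i) (trans eq (nextArc-tail (arc s (suc i))))

    -- Treats both ways of closing up at once: meeting the walk itself, or meeting its mirror image
    -- across the rungs.
    twist : Bool → Fin n → Fin n
    twist true  = λ u → u
    twist false = ρ

    twist-walk : ∀ s {a} → IsWalk a → IsWalk (twist s ∘ a)
    twist-walk true  w = w
    twist-walk false w = ρ-walk w

    module _ {a : ℕ → Fin n} (A : IsWalk a) where

      twist-≢₁ : ∀ s i → a i ≢ twist s (a (suc i))
      twist-≢₁ true  i = ∼⇒≢ (step A i)
      twist-≢₁ false i = noRung′ A i

      twist-≢₂ : ∀ s i → a i ≡ twist s (a (2 + i)) → a (suc i) ≡ twist s (a (suc i)) → ⊥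
      twist-≢₂ true  i eq _  = noBack A i eq
      twist-≢₂ false i _  eq = ∼⇒≢ (ρ-adj _) eq

      -- Such a fold of the walk onto itself or its ρ-image would fix a vertex or an edge in the middle.
      no-reflection : ∀ s d i → a i ≡ twist s (a (suc d + i)) → a (suc i) ≡ twist s (a (d + i)) → ⊥
      no-reflection s 0 i e e′ = twist-≢₁ s i e
      no-reflection s 1 i e e′ = twist-≢₂ s i e e′
      no-reflection s (suc (suc d)) i e e′ = no-reflection s d (suc i)
        (trans e′ (cong (twist s ∘ a ∘ suc) (sym (+-suc d i))))
        (trans (walk-reflect A (twist-walk s A) i (suc d + i) e e′) (cong (twist s ∘ a) (sym (+-suc d i))))

      module _ (s : Bool) (d : ℕ) where
        private
          -- Coincidence at two consecutive places, the form that propagates along walks.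
          Shift : ℕ → Set
          Shift i = a i ≡ twist s (a (suc d + i)) × a (suc i) ≡ twist s (a (suc d + suc i))

          reindex : ∀ i → twist s (a (2 + d + i)) ≡ twist s (a (suc d + suc i))
          reindex i = cong (twist s ∘ a ∘ suc) (sym (+-suc d i))

          shift-down : ∀ i → Shift i → Shift 0
          shift-down zero p = p
          shift-down (suc i) (e , e′) = shift-down i
            (walk-backward A (twist-walk s A) i (suc d + i) (trans e (sym (reindex i)))
              (trans e′ (cong (twist s ∘ a) (trans (+-suc (suc d) (suc i)) (cong suc (+-suc (suc d) i))))) , e)

          shift-up : Shift 0 → ∀ i → Shift i
          shift-up p zero = p
          shift-up p (suc i) with shift-up p i
          ... | e , e′ = e′ , trans (walk-forward A (twist-walk s A) i (suc d + i) e (trans e′ (sym (reindex i))))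
            (cong (twist s ∘ a) (sym (trans (+-suc (suc d) (suc i)) (cong suc (+-suc (suc d) i)))))

        -- At the coincidence the twisted walk runs either along with `a`, and then agreement
        -- spreads down to 0 and up to every index, or against it, which `no-reflection` excludes.
        shift : ∀ i → a i ≡ twist s (a (suc d + i)) → ∀ j → a j ≡ twist s (a (suc d + j))
        shift i e j with walk-branch A (twist-walk s A) i (d + i) e
        ... | inj₁ e′ = proj₁ (shift-up (shift-down i (e , trans e′ (reindex i))) j)
        ... | inj₂ e′ = ⊥-elim (no-reflection s d i e e′)

      shift₀ : ∀ s d i → a i ≡ twist s (a (suc d + i)) → a 0 ≡ twist s (a (suc d))
      shift₀ s d i e = trans (shift s d i e 0) (cong (twist s ∘ a) (+-identityʳ (suc d)))

      -- The index `d` stands for `suc d` steps, so the trivial return after no step is left out.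
      Returns : ℕ → Set
      Returns d = a 0 ≡ a (suc d) ⊎ a 0 ≡ ρ (a (suc d))

      returns? : Decidable Returns
      returns? d = (a 0 ≟ᶠ a (suc d)) ⊎-dec (a 0 ≟ᶠ ρ (a (suc d)))

      -- Among `n + 1` places of the walk two carry the same vertex, and `shift₀` moves this
      -- coincidence back to the start.
      returns : ∃[ d ] Returns d
      returns with pigeonhole (n<1+n n) (a ∘ toℕ)
      ... | i , j , i<j , eq with <⇒∃ i<j
      ... | d , j≡ = d , inj₁ (shift₀ true d (toℕ i) (trans eq (cong a j≡)))

      module _ {m} (min : ∀ {d} → d < m → ¬ Returns d) where

        twist-min : ∀ s {d} → d < m → a 0 ≢ twist s (a (suc d))
        twist-min true  d<m eq = min d<m (inj₁ eq)
        twist-min false d<m eq = min d<m (inj₂ eq)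

        distinct : ∀ s {i j} → i < j → j < suc m → a i ≢ twist s (a j)
        distinct s {i} i<j j<m eq with <⇒∃ i<j
        ... | d , refl = twist-min s (≤-<-trans (m≤m+n d i) (≤-pred j<m)) (shift₀ s d i eq)

        -- `not (s xor t)` is the product of the two twists, since `true` is the identity and `ρ` is
        -- an involution.
        twist-xor : ∀ s t {u v} → twist s u ≡ twist t v → u ≡ twist (not (s xor t)) v
        twist-xor true  true  eq = eq
        twist-xor true  false eq = eq
        twist-xor false true  eq = sym (trans (sym (cong ρ eq)) (ρ-involutive _))
        twist-xor false false eq = ρ-injective eq

        xor-≡ : ∀ s t {u} → u ≡ twist (not (s xor t)) u → s ≡ t
        xor-≡ true  true  _  = refl
        xor-≡ true  false eq = contradiction eq (∼⇒≢ (ρ-adj _))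
        xor-≡ false true  eq = contradiction eq (∼⇒≢ (ρ-adj _))
        xor-≡ false false _  = refl

        twist-injective : ∀ {s t i j} → i < suc m → j < suc m → twist s (a i) ≡ twist t (a j) → s ≡ t × i ≡ j
        twist-injective {s} {t} {i} {j} i<m j<m eq with <-cmp i j
        ... | tri< i<j _ _  = contradiction (twist-xor s t eq) (distinct (not (s xor t)) i<j j<m)
        ... | tri> _ _ j<i  = contradiction (twist-xor t s (sym eq)) (distinct (not (t xor s)) j<i i<m)
        ... | tri≈ _ refl _ = xor-≡ s t (twist-xor s t eq) , refl

        prism-case : a 0 ≡ a (suc m) → 4 ≤ suc m × _≅_ Γ (Prism (suc m))
        prism-case eq = 4≤ m eq , prism-≅ m (λ s i → twist s (a i)) period
          (λ s → step (twist-walk s A)) (λ i → ρ-adj (a i)) (λ s → noBack (twist-walk s A)) twist-injective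
          where
          period : ∀ s i → twist s (a (suc m + i)) ≡ twist s (a i)
          period s i = cong (twist s)
            (sym (shift true m 0 (trans eq (cong a (sym (+-identityʳ (suc m))))) i))
          -- A rail closing after 1, 2 or 3 steps would be a loop, a reversal or a triangle.
          4≤ : ∀ m → a 0 ≡ a (suc m) → 4 ≤ suc m
          4≤ 0 e = contradiction e (∼⇒≢ (step A 0))
          4≤ 1 e = contradiction e (noBack A 0)
          4≤ 2 e = ⊥-elim (triangle-free (step A 0) (step A 1) (∼-sym (subst (a 2 ∼_) (sym e) (step A 2))))
          4≤ (suc (suc (suc _))) _ = s≤s (s≤s (s≤s (s≤s z≤n)))

        möbius-case : a 0 ≡ ρ (a (suc m)) → 3 ≤ suc m × _≅_ Γ (Möbius (suc m))
        möbius-case eq = 3≤ m eq , möbius-≅ m a period (step A)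
          (λ i → subst (a i ∼_) (sym (half i)) (ρ-adj (a i))) (noBack A)
          (λ i e → noRung A i (trans e (half i)))
          (λ i e → noRung′ A i (trans e (half (suc i)))) inj
          where
          M = suc m
          -- The closing coincidence shifted to every index: `M` steps amount to `ρ`, so `2M` steps
          -- are the identity.
          half : ∀ i → a (M + i) ≡ ρ (a i)
          half i = sym (ρ-flip (shift false m 0 (trans eq (cong (ρ ∘ a) (sym (+-identityʳ M)))) i))
          period : ∀ i → a (M + M + i) ≡ a i
          period i = trans (cong a (+-assoc M M i))
            (trans (half (M + i)) (trans (cong ρ (half i)) (ρ-involutive (a i))))
          3≤ : ∀ m → a 0 ≡ ρ (a (suc m)) → 3 ≤ suc m
          3≤ 0 e = contradiction e (noRung′ A 0)
          3≤ 1 e = ⊥-elim (triangle-free (step A 0) (step A 1) (subst (a 0 ∼_) (ρ-flip e) (ρ-adj (a 0))))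
          3≤ (suc (suc _)) _ = s≤s (s≤s (s≤s z≤n))
          -- A return in fewer than `M` steps violates minimality, and one in exactly `M` would make
          -- `a 0` its own rung mate. A later one becomes, by `half`, a return across the rung in
          -- fewer than `M` steps.
          no-return : ∀ d → suc d < M + M → a 0 ≢ a (suc d)
          no-return d d<2M e with <-cmp d m
          ... | tri< d<m _ _ = min d<m (inj₁ e)
          ... | tri≈ _ refl _ = ∼⇒≢ (ρ-adj (a 0)) (trans e (sym (ρ-flip eq)))
          ... | tri> _ _ m<d with m≤n⇒∃[o]m+o≡n m<d
          ... | o , refl = min {o} (+-cancelˡ-< M o m (subst (suc (M + o) ≤_) (+-suc m m) (≤-pred d<2M)))
                (inj₂ (trans e (trans (cong (a ∘ suc) (sym (+-suc m o))) (half (suc o)))))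
          ordered : ∀ {i j} → i < j → j < M + M → a i ≢ a j
          ordered {i} i<j j<2M e with <⇒∃ i<j
          ... | d , refl = no-return d (≤-<-trans (m≤m+n (suc d) i) j<2M) (shift₀ true d i e)
          inj : ∀ {i j} → i < M + M → j < M + M → a i ≡ a j → i ≡ j
          inj {i} {j} i< j< e with <-cmp i j
          ... | tri< i<j _ _ = contradiction e (ordered i<j j<)
          ... | tri≈ _ i≡j _ = i≡j
          ... | tri> _ _ j<i = contradiction (sym e) (ordered j<i i<)

    initial-arc : Fin n → Arc
    initial-arc u with others (ρ-adj u)
    ... | x , _ , N = u , x , ∼₂ N , ≢-sym (≢₁₂ N)

    ladder : Fin n → (Σ ℕ λ m → 3 ≤ m × _≅_ Γ (Möbius m)) ⊎ (Σ ℕ λ m → 4 ≤ m × _≅_ Γ (Prism m))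
    ladder u with least (returns? A) (proj₁ (returns A)) (proj₂ (returns A))
      where A = walk-isWalk (initial-arc u)
    ... | m , inj₁ e , min = inj₂ (suc m , prism-case (walk-isWalk (initial-arc u)) min e)
    ... | m , inj₂ e , min = inj₁ (suc m , möbius-case (walk-isWalk (initial-arc u)) min e)

-- Canonical list elements and squares on a 2-path.

module _ {A : Set} where

  -- The membership proof serves to rule out the empty list, so equal lists yield equal elements
  -- whatever the proofs.
  first : {x : A} (xs : List A) → x ∈ xs → A
  first (y ∷ _) _ = y

  first-∈ : {x : A} (xs : List A) (m : x ∈ xs) → first xs m ∈ xs
  first-∈ (y ∷ _) _ = here refl

  first-cong : {x y : A} {xs ys : List A} (p : x ∈ xs) (q : y ∈ ys) → xs ≡ ys → first xs p ≡ first ys q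
  first-cong {xs = _ ∷ _} _ _ refl = refl

≡-from-⇔true : ∀ {a b} → (a ≡ true → b ≡ true) → (b ≡ true → a ≡ true) → a ≡ b
≡-from-⇔true {true}  {b}     f g = sym (f refl)
≡-from-⇔true {false} {true}  f g = g refl
≡-from-⇔true {false} {false} f g = refl

module Squares (Γ : SimpleGraph) where
  open Graph Γ

  -- For distinct neighbours `x`, `y` of `u` this is a 4-cycle through the path x, u, y, with `p` as
  -- its fourth vertex.
  Sq : (u x y : Fin n) → Set
  Sq u x y = ∃[ p ] (p ≢ u × x ∼ p × y ∼ p)

  Sq-sym : ∀ {u x y} → Sq u x y → Sq u y x
  Sq-sym (p , pu , xp , yp) = p , pu , yp , xp

-- One square at each vertex: contracting the squares.

module Truncation (Γ : SimpleGraph) (cubic : Cubic Γ) where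
  open CubicGraph Γ cubic
  open Squares Γ
  open import Data.List.Membership.DecPropositional (_≟ᶠ_ {n}) using (_∈?_)

  module _ (unique-square : ∀ u → ∃[ l ] ∃[ r ] ∃[ m ] (Nbrs u l r m × Sq u l r × ¬ Sq u l m × ¬ Sq u r m)) where

    -- The mate of `u`: the other end of the one edge at `u` outside its square.
    μ : Fin n → Fin n
    μ u = proj₁ (proj₂ (proj₂ (unique-square u)))

    ∼-μ : ∀ u → u ∼ μ u
    ∼-μ u with unique-square u
    ... | _ , _ , _ , N , _ = ∼₃ N

    infix 4 _⌢_
    _⌢_ : Fin n → Fin n → Set
    u ⌢ v = u ∼ v × v ≢ μ u

    -- A square using the edge to the mate would be one of the two that `unique-square` excludes.
    Sq⇒≢μ : ∀ {u x y} → u ∼ y → x ≢ y → Sq u x y → x ≢ μ u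
    Sq⇒≢μ {u} uy xy s refl with unique-square u
    ... | l , r , m , N , _ , ¬lm , ¬rm with complete N uy
    ... | inj₁ refl = ¬lm (Sq-sym s)
    ... | inj₂ (inj₁ refl) = ¬rm (Sq-sym s)
    ... | inj₂ (inj₂ refl) = xy refl

    Sq⇒Nbrs : ∀ {u x y} → u ∼ x → u ∼ y → x ≢ y → Sq u x y → Nbrs u x y (μ u)
    Sq⇒Nbrs {u} ux uy xy s =
      mkNbrs ux uy (∼-μ u) xy (Sq⇒≢μ uy xy s) (Sq⇒≢μ ux (≢-sym xy) (Sq-sym s))

    -- The cyclic order of the corners is `u`, `l`, `o`, `r`. Read from any corner it is again a
    -- square, so at each corner the remaining neighbour is the mate.
    record Square (u : Fin n) : Set where
      field
        l r o : Fin n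
        u∼l : u ∼ l
        u∼r : u ∼ r
        l∼o : l ∼ o
        r∼o : r ∼ o
        l≢r : l ≢ r
        o≢u : o ≢ u

      u-nbrs : Nbrs u l r (μ u)
      u-nbrs = Sq⇒Nbrs u∼l u∼r l≢r (o , o≢u , l∼o , r∼o)

      l-nbrs : Nbrs l u o (μ l)
      l-nbrs = Sq⇒Nbrs (∼-sym u∼l) l∼o (≢-sym o≢u) (r , ≢-sym l≢r , u∼r , ∼-sym r∼o)

      r-nbrs : Nbrs r u o (μ r)
      r-nbrs = Sq⇒Nbrs (∼-sym u∼r) r∼o (≢-sym o≢u) (l , l≢r , u∼l , ∼-sym l∼o)

      o-nbrs : Nbrs o l r (μ o)
      o-nbrs = Sq⇒Nbrs (∼-sym l∼o) (∼-sym r∼o) l≢r (u , ≢-sym o≢u , ∼-sym u∼l , ∼-sym u∼r)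

      vertices : List (Fin n)
      vertices = u ∷ l ∷ r ∷ o ∷ []

      vertices-unique : Unique vertices
      vertices-unique = (∼⇒≢ u∼l ∷ ∼⇒≢ u∼r ∷ ≢-sym o≢u ∷ []) ∷ (l≢r ∷ ∼⇒≢ l∼o ∷ []) ∷ (∼⇒≢ r∼o ∷ []) ∷ [] ∷ []

    square : ∀ u → Square u
    square u with unique-square u
    ... | l , r , m , N , (o , o≢u , l∼o , r∼o) , _ = record
      { l = l ; r = r ; o = o ; u∼l = ∼₁ N ; u∼r = ∼₂ N ; l∼o = l∼o ; r∼o = r∼o ; l≢r = ≢₁₂ N ; o≢u = o≢u }

    open Square

    two-⌢ : ∀ {u x y w} → Nbrs u x y (μ u) → u ⌢ w → w ≡ x ⊎ w ≡ y
    two-⌢ N (uw , wμ) with complete N uw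
    ... | inj₁ e = inj₁ e
    ... | inj₂ (inj₁ e) = inj₂ e
    ... | inj₂ (inj₂ e) = contradiction e wμ

    -- `v` is the corner `l` or `r` in the square of `u`, and the same square seen from there shows
    -- that `u` is not the mate of `v`.
    ⌢-sym : ∀ {u v} → u ⌢ v → v ⌢ u
    ⌢-sym {u} u⌢v@(uv , _) with two-⌢ (u-nbrs (square u)) u⌢v
    ... | inj₁ refl = ∼-sym uv , ≢₁₃ (l-nbrs (square u))
    ... | inj₂ refl = ∼-sym uv , ≢₁₃ (r-nbrs (square u))

    -- If `u` were not the mate of `μ u`, then `μ u ⌢ u`, and symmetry would give `u ⌢ μ u`.
    μ-involutive : ∀ u → μ (μ u) ≡ u
    μ-involutive u with u ≟ᶠ μ (μ u)
    ... | yes e = sym e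
    ... | no ne = contradiction refl (proj₂ (⌢-sym (∼-sym (∼-μ u) , ne)))

    _≈_ : Fin n → Fin n → Set
    _≈_ = Star _⌢_

    ∈⇒≈ : ∀ {u w} → w ∈ vertices (square u) → u ≈ w
    ∈⇒≈ {u} (here refl) = done
    ∈⇒≈ {u} (there (here refl)) = (u∼l (square u) , ≢₁₃ (u-nbrs (square u))) ◅ done
    ∈⇒≈ {u} (there (there (here refl))) = (u∼r (square u) , ≢₂₃ (u-nbrs (square u))) ◅ done
    ∈⇒≈ {u} (there (there (there (here refl)))) =
      (u∼l (square u) , ≢₁₃ (u-nbrs (square u))) ◅ (l∼o (square u) , ≢₂₃ (l-nbrs (square u))) ◅ done

    -- Both `⌢`-neighbours of each corner are corners. Hence the `⌢`-component of `u` is its square,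
    -- which makes `≈` decidable.
    ∈-closed : ∀ {u w w′} → w ∈ vertices (square u) → w ⌢ w′ → w′ ∈ vertices (square u)
    ∈-closed {u} (here refl) s with two-⌢ (u-nbrs (square u)) s
    ... | inj₁ e = there (here e)
    ... | inj₂ e = there (there (here e))
    ∈-closed {u} (there (here refl)) s with two-⌢ (l-nbrs (square u)) s
    ... | inj₁ e = here e
    ... | inj₂ e = there (there (there (here e)))
    ∈-closed {u} (there (there (here refl))) s with two-⌢ (r-nbrs (square u)) s
    ... | inj₁ e = here e
    ... | inj₂ e = there (there (there (here e)))
    ∈-closed {u} (there (there (there (here refl)))) s with two-⌢ (o-nbrs (square u)) s
    ... | inj₁ e = there (here e)
    ... | inj₂ e = there (there (here e))

    ≈⇒∈ : ∀ {u w} → u ≈ w → w ∈ vertices (square u)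
    ≈⇒∈ = go (here refl)
      where
      go : ∀ {u v w} → v ∈ vertices (square u) → v ≈ w → w ∈ vertices (square u)
      go m done = m
      go m (s ◅ ss) = go (∈-closed m s) ss

    -- Filtering `allFin n` lists the corners in an order common to all of them, so that the first
    -- entry is canonical.
    class : Fin n → List (Fin n)
    class u = filter (_∈? vertices (square u)) (allFin n)

    self∈class : ∀ u → u ∈ class u
    self∈class u = ∈-filter⁺ (_∈? vertices (square u)) (∈-allFin u) (here refl)

    representative : Fin n → Fin n
    representative u = first (class u) (self∈class u)

    representative-≈ : ∀ u → u ≈ representative u
    representative-≈ u = ∈⇒≈ (proj₂ (∈-filter⁻ (_∈? vertices (square u)) {xs = allFin n} (first-∈ (class u) (self∈class u))))

    representative-cong : ∀ {u w} → u ≈ w → representative u ≡ representative w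
    representative-cong {u} {w} uw = first-cong (self∈class u) (self∈class w)
      (filter-≐ (_∈? vertices (square u)) (_∈? vertices (square w))
        ((λ m → ≈⇒∈ (reverse ⌢-sym uw ◅◅ ∈⇒≈ m)) , (λ m → ≈⇒∈ (uw ◅◅ ∈⇒≈ m))) (allFin n))

    isRepresentative? : ∀ u → Dec (representative u ≡ u)
    isRepresentative? u = representative u ≟ᶠ u

    representatives : List (Fin n)
    representatives = filter isRepresentative? (allFin n)

    representative∈ : ∀ u → representative u ∈ representatives
    representative∈ u = ∈-filter⁺ isRepresentative? (∈-allFin _) (sym (representative-cong (representative-≈ u)))

    -- Abstract so that conversion checking never unfolds the enumeration of representatives.
    abstract
      π : Fin n → Fin (length representatives)
      π u = index (representative∈ u)

      lookup-π : ∀ u → representative u ≡ lookup representatives (π u)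
      lookup-π u = lookup-index (representative∈ u)

      representatives-unique : Unique representatives
      representatives-unique = filter⁺ isRepresentative? (allFin⁺ n)

      ≈⇒π : ∀ {u w} → u ≈ w → π u ≡ π w
      ≈⇒π {u} {w} uw = lookup-injective representatives-unique
        (trans (sym (lookup-π u)) (trans (representative-cong uw) (lookup-π w)))

      π⇒≈ : ∀ {u w} → π u ≡ π w → u ≈ w
      π⇒≈ {u} {w} e = subst (u ≈_) same (representative-≈ u) ◅◅ reverse ⌢-sym (representative-≈ w)
        where
        same : representative u ≡ representative w
        same = trans (lookup-π u) (trans (cong (lookup representatives) e) (sym (lookup-π w)))

      π-surjective : ∀ v → ∃[ u ] π u ≡ v
      π-surjective v = u , lookup-injective representatives-unique (trans (sym (lookup-π u)) fixed)
        where
        u : Fin n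
        u = lookup representatives v
        fixed : representative u ≡ u
        fixed = proj₂ (∈-filter⁻ isRepresentative? {xs = allFin n} (∈-lookup {xs = representatives} v))

    -- Arcs of the contracted graph as vertices of the original one.

    lower? : ∀ u → Dec (toℕ u < toℕ (μ u))
    lower? u = toℕ u <? toℕ (μ u)

    -- Lists each edge between mates once, by its end of smaller index.
    lowers : List (Fin n)
    lowers = filter lower? (allFin n)

    lowers-unique : Unique lowers
    lowers-unique = filter⁺ lower? (allFin⁺ n)

    -- An arc is identified with the vertex through which it leaves its square; reversing the arc is
    -- then `μ`.
    vertex : Fin (length lowers) × Bool → Fin n
    vertex (e , true)  = lookup lowers e
    vertex (e , false) = μ (lookup lowers e)

    Λ : MultiGraph
    Λ = record { nV = length representatives ; nE = length lowers ; ends = λ e b → π (vertex (e , b)) }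

    open MultiGraph Λ using (Arc; tail; inv; arcs; Tetravalent; DihedralScheme; Tr)

    lowers-< : ∀ e → toℕ (lookup lowers e) < toℕ (μ (lookup lowers e))
    lowers-< e = proj₂ (∈-filter⁻ lower? {xs = allFin n} (∈-lookup {xs = lowers} e))

    μ-injective : ∀ {u v} → μ u ≡ μ v → u ≡ v
    μ-injective {u} {v} e = trans (sym (μ-involutive u)) (trans (cong μ e) (μ-involutive v))

    lowers-≢ : ∀ e f → lookup lowers e ≢ μ (lookup lowers f)
    lowers-≢ e f eq = <-asym (lowers-< f)
      (subst₂ (λ x y → toℕ x < toℕ y) eq (trans (cong μ eq) (μ-involutive _)) (lowers-< e))

    vertex-injective : ∀ {s t} → vertex s ≡ vertex t → s ≡ t
    vertex-injective {e , true}  {f , true}  eq = cong (_, true) (lookup-injective lowers-unique eq)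
    vertex-injective {e , true}  {f , false} eq = contradiction eq (lowers-≢ e f)
    vertex-injective {e , false} {f , true}  eq = contradiction (sym eq) (lowers-≢ f e)
    vertex-injective {e , false} {f , false} eq = cong (_, false) (lookup-injective lowers-unique (μ-injective eq))

    vertex-surjective : ∀ u → ∃[ s ] vertex s ≡ u
    vertex-surjective u with <-cmp (toℕ u) (toℕ (μ u))
    ... | tri< lt _ _ = (index m , true) , sym (lookup-index m)
      where
      m : u ∈ lowers
      m = ∈-filter⁺ lower? (∈-allFin u) lt
    ... | tri≈ _ eq _ = contradiction (toℕ-injective eq) (∼⇒≢ (∼-μ u))
    ... | tri> _ _ gt = (index m , false) , trans (cong μ (sym (lookup-index m))) (μ-involutive u)
      where
      m : μ u ∈ lowers
      m = ∈-filter⁺ lower? (∈-allFin (μ u)) (subst (λ x → toℕ (μ u) < toℕ x) (sym (μ-involutive u)) gt)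

    arcOf : Fin n → Arc
    arcOf u = proj₁ (vertex-surjective u)

    vertex-arcOf : ∀ u → vertex (arcOf u) ≡ u
    vertex-arcOf u = proj₂ (vertex-surjective u)

    vertex-inv : ∀ s → vertex (inv s) ≡ μ (vertex s)
    vertex-inv (e , true)  = refl
    vertex-inv (e , false) = sym (μ-involutive _)

    arcs≡product : arcs ≡ cartesianProduct (allFin (length lowers)) (true ∷ false ∷ [])
    arcs≡product = go (allFin (length lowers))
      where
      go : ∀ es → concatMap (λ e → (e , true) ∷ (e , false) ∷ []) es ≡ cartesianProduct es (true ∷ false ∷ [])
      go [] = refl
      go (e ∷ es) = cong (λ xs → (e , true) ∷ (e , false) ∷ xs) (go es)

    arcs-unique : Unique arcs
    arcs-unique = subst Unique (sym arcs≡product)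
      (cartesianProduct⁺ (allFin⁺ _) (((λ ()) ∷ []) ∷ [] ∷ []))

    ∈-arcs : ∀ s → s ∈ arcs
    ∈-arcs (e , b) = subst ((e , b) ∈_) (sym arcs≡product) (∈-cartesianProduct⁺ (∈-allFin e) (bool b))
      where
      bool : ∀ b → b ∈ true ∷ false ∷ []
      bool true  = here refl
      bool false = there (here refl)

    -- The bijection `vertex` carries the selected arcs to an explicit list of vertices; both
    -- valency counts reduce to this.
    count-arcs : {P : Arc → Set} (P? : ∀ s → Dec (P s)) {vs : List (Fin n)} → Unique vs →
      (∀ {s} → P s → vertex s ∈ vs) → (∀ {s} → vertex s ∈ vs → P s) → length (filter P? arcs) ≡ length vs
    count-arcs {P} P? {vs} uniq to from = trans (sym (length-map vertex (filter P? arcs)))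
      (↭-length (unique-set⇒↭ (map⁺ vertex-injective (filter⁺ P? arcs-unique)) uniq to′ from′))
      where
      to′ : ∀ {z} → z ∈ map vertex (filter P? arcs) → z ∈ vs
      to′ m with ∈-map⁻ vertex m
      ... | s , s∈ , refl = to (proj₂ (∈-filter⁻ P? {xs = arcs} s∈))
      from′ : ∀ {z} → z ∈ vs → z ∈ map vertex (filter P? arcs)
      from′ {z} m = subst (_∈ map vertex (filter P? arcs)) (vertex-arcOf z)
        (∈-map⁺ vertex (∈-filter⁺ P? (∈-arcs (arcOf z)) (from (subst (_∈ vs) (sym (vertex-arcOf z)) m))))

    -- The arcs leaving a contracted square correspond to its four corners.
    tetravalent : Tetravalent
    tetravalent v = count-arcs (λ s → tail s ≟ᶠ v) (vertices-unique (square u))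
      (λ {s} e → ≈⇒∈ (π⇒≈ {u} {vertex s} (trans πu≡v (sym e))))
      (λ {s} m → trans (sym (≈⇒π {u} {vertex s} (∈⇒≈ m))) πu≡v)
      where
      u : Fin n
      u = proj₁ (π-surjective v)
      πu≡v : π u ≡ v
      πu≡v = proj₂ (π-surjective v)

    rel : Arc → Arc → Bool
    rel s t = adj (vertex s) (vertex t) ∧ not ⌊ vertex t ≟ᶠ μ (vertex s) ⌋

    rel⇒⌢ : ∀ s t → rel s t ≡ true → vertex s ⌢ vertex t
    rel⇒⌢ s t e with adj (vertex s) (vertex t) | vertex t ≟ᶠ μ (vertex s)
    rel⇒⌢ s t e | true | no ne = refl , ne

    ⌢⇒rel : ∀ s t → vertex s ⌢ vertex t → rel s t ≡ true
    ⌢⇒rel s t (st , ne) with vertex t ≟ᶠ μ (vertex s)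
    ... | yes e = contradiction e ne
    ... | no _ rewrite st = refl

    ≈⇒Star : ∀ s t → vertex s ≈ vertex t → Star (λ a b → rel a b ≡ true) s t
    ≈⇒Star s t p = subst₂ (Star _) (arcOf-vertex s) (arcOf-vertex t)
      (gmap arcOf (λ {u} {v} uv → ⌢⇒rel (arcOf u) (arcOf v) (subst₂ _⌢_ (sym (vertex-arcOf u)) (sym (vertex-arcOf v)) uv)) p)
      where
      arcOf-vertex : ∀ s → arcOf (vertex s) ≡ s
      arcOf-vertex s = vertex-injective (vertex-arcOf (vertex s))

    scheme : DihedralScheme
    scheme = record
      { rel        = rel
      ; rel-sym    = λ s t → ≡-from-⇔true (⌢⇒rel t s ∘ ⌢-sym ∘ rel⇒⌢ s t) (⌢⇒rel s t ∘ ⌢-sym ∘ rel⇒⌢ t s)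
      ; rel-irr    = λ s → ≡-from-⇔true (λ e → contradiction refl (∼⇒≢ (proj₁ (rel⇒⌢ s s e)))) (λ ())
      ; two-reg    = two
      ; components = λ s t → mk⇔ (λ p → ≈⇒π (gmap vertex (λ {s} {t} → rel⇒⌢ s t) p)) (λ e → ≈⇒Star s t (π⇒≈ e))
      }
      where
      two : ∀ s → length (filter (λ t → rel s t ≟ᵇ true) arcs) ≡ 2
      two s = count-arcs (λ t → rel s t ≟ᵇ true) ((l≢r S ∷ []) ∷ [] ∷ []) (λ {t} → to t) (λ {t} → from t)
        where
        S = square (vertex s)
        to : ∀ t → rel s t ≡ true → vertex t ∈ l S ∷ r S ∷ []
        to t e with two-⌢ (u-nbrs S) (rel⇒⌢ s t e)
        ... | inj₁ e = here e
        ... | inj₂ e = there (here e)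
        from : ∀ t → vertex t ∈ l S ∷ r S ∷ [] → rel s t ≡ true
        from t (here e) = ⌢⇒rel s t (subst (vertex s ⌢_) (sym e) (u∼l S , ≢₁₃ (u-nbrs S)))
        from t (there (here e)) = ⌢⇒rel s t (subst (vertex s ⌢_) (sym e) (u∼r S , ≢₂₃ (u-nbrs S)))

    -- An edge joins mates, and then pairs inverse arcs, or lies on a square, and then belongs to
    -- the scheme.
    truncation-≅ : _≅_ Γ (Tr scheme)
    truncation-≅ = mk↔ₛ′ arcOf vertex (λ s → vertex-injective (vertex-arcOf (vertex s))) vertex-arcOf ,
      λ u v → mk⇔ (to u v) (from u v)
      where
      to : ∀ u v → u ∼ v → rel (arcOf u) (arcOf v) ≡ true ⊎ inv (arcOf u) ≡ arcOf v
      to u v uv with v ≟ᶠ μ u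
      ... | yes e = inj₂ (vertex-injective
        (trans (vertex-inv (arcOf u)) (trans (cong μ (vertex-arcOf u)) (trans (sym e) (sym (vertex-arcOf v))))))
      ... | no ne = inj₁ (⌢⇒rel (arcOf u) (arcOf v) (subst₂ _⌢_ (sym (vertex-arcOf u)) (sym (vertex-arcOf v)) (uv , ne)))
      from : ∀ u v → rel (arcOf u) (arcOf v) ≡ true ⊎ inv (arcOf u) ≡ arcOf v → u ∼ v
      from u v (inj₁ e) = subst₂ _∼_ (vertex-arcOf u) (vertex-arcOf v) (proj₁ (rel⇒⌢ (arcOf u) (arcOf v) e))
      from u v (inj₂ e) = subst (u ∼_) (trans (cong μ (sym (vertex-arcOf u)))
        (trans (sym (vertex-inv (arcOf u))) (trans (cong vertex e) (vertex-arcOf v)))) (∼-μ u)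

    truncation : Σ MultiGraph λ Λ → MultiGraph.Tetravalent Λ
      × Σ (MultiGraph.DihedralScheme Λ) λ D → _≅_ Γ (MultiGraph.Tr Λ D)
    truncation = Λ , tetravalent , scheme , truncation-≅

-- Boolean cycle tests, lists of vertices and common neighbours.

∧-true⁻ : ∀ {a b} → a ∧ b ≡ true → a ≡ true × b ≡ true
∧-true⁻ {true} {true} _ = refl , refl

∧-true⁺ : ∀ {a b} → a ≡ true → b ≡ true → a ∧ b ≡ true
∧-true⁺ refl refl = refl

module Cycles (Γ : SimpleGraph) where
  open Graph Γ
  open Squares Γ

  elemᵇ⁻ : ∀ x ys → not (elemᵇ Γ x ys) ≡ true → All (x ≢_) ys
  elemᵇ⁻ x [] _ = []
  elemᵇ⁻ x (y ∷ ys) e with x ≟ᶠ y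
  ... | no x≢y = x≢y ∷ elemᵇ⁻ x ys e

  elemᵇ⁺ : ∀ x {ys} → All (x ≢_) ys → not (elemᵇ Γ x ys) ≡ true
  elemᵇ⁺ x [] = refl
  elemᵇ⁺ x {y ∷ ys} (x≢y ∷ ps) with x ≟ᶠ y
  ... | yes e = contradiction e x≢y
  ... | no _  = elemᵇ⁺ x ps

  nodupᵇ⁻ : ∀ xs → nodupᵇ Γ xs ≡ true → Unique xs
  nodupᵇ⁻ [] _ = []
  nodupᵇ⁻ (x ∷ xs) e with ∧-true⁻ {not (elemᵇ Γ x xs)} e
  ... | p , q = elemᵇ⁻ x xs p ∷ nodupᵇ⁻ xs q

  nodupᵇ⁺ : ∀ {xs} → Unique xs → nodupᵇ Γ xs ≡ true
  nodupᵇ⁺ [] = refl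
  nodupᵇ⁺ (p ∷ ps) = ∧-true⁺ (elemᵇ⁺ _ p) (nodupᵇ⁺ ps)

  isCycle₃⁺ : ∀ {u v w} → Unique (u ∷ v ∷ w ∷ []) → u ∼ v → v ∼ w → w ∼ u → isCycle Γ (u ∷ v ∷ w ∷ []) ≡ true
  isCycle₃⁺ uniq uv vw wu = ∧-true⁺ (nodupᵇ⁺ uniq) (∧-true⁺ (∧-true⁺ uv (∧-true⁺ vw refl)) wu)

  isCycle₄⁺ : ∀ {u v w x} → Unique (u ∷ v ∷ w ∷ x ∷ []) → u ∼ v → v ∼ w → w ∼ x → x ∼ u →
    isCycle Γ (u ∷ v ∷ w ∷ x ∷ []) ≡ true
  isCycle₄⁺ uniq uv vw wx xu =
    ∧-true⁺ (nodupᵇ⁺ uniq) (∧-true⁺ (∧-true⁺ uv (∧-true⁺ vw (∧-true⁺ wx refl))) xu)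

  isCycle₄⁻ : ∀ {u v w x} → isCycle Γ (u ∷ v ∷ w ∷ x ∷ []) ≡ true →
    Unique (u ∷ v ∷ w ∷ x ∷ []) × u ∼ v × v ∼ w × w ∼ x × x ∼ u
  isCycle₄⁻ {u} {v} {w} {x} e with ∧-true⁻ {nodupᵇ Γ (u ∷ v ∷ w ∷ x ∷ [])} e
  ... | nd , e₁ with ∧-true⁻ {pathᵇ Γ (u ∷ v ∷ w ∷ x ∷ [])} e₁
  ... | path , xu with ∧-true⁻ {adj u v} path
  ... | uv , e₂ with ∧-true⁻ {adj v w} e₂
  ... | vw , e₃ with ∧-true⁻ {adj w x} e₃
  ... | wx , _ = nodupᵇ⁻ _ nd , uv , vw , wx , xu

  allLists≡product : ∀ k → allLists Γ (suc k) ≡ cartesianProductWith _∷_ (allFin n) (allLists Γ k)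
  allLists≡product k = go (allFin n)
    where
    go : ∀ vs → concatMap (λ v → map (v ∷_) (allLists Γ k)) vs ≡ cartesianProductWith _∷_ vs (allLists Γ k)
    go [] = refl
    go (v ∷ vs) = cong (map (v ∷_) (allLists Γ k) ++_) (go vs)

  allLists-unique : ∀ k → Unique (allLists Γ k)
  allLists-unique 0 = [] ∷ []
  allLists-unique (suc k) = subst Unique (sym (allLists≡product k))
    (cartesianProductWith⁺ _∷_ ∷-injective (allFin⁺ n) (allLists-unique k))

  ∈-allLists : ∀ xs → xs ∈ allLists Γ (length xs)
  ∈-allLists [] = here refl
  ∈-allLists (x ∷ xs) = subst (_ ∈_) (sym (allLists≡product (length xs)))
    (∈-cartesianProductWith⁺ _∷_ (∈-allFin x) (∈-allLists xs))

  allLists-length : ∀ k {xs} → xs ∈ allLists Γ k → length xs ≡ k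
  allLists-length 0 (here refl) = refl
  allLists-length (suc k) m
    with ∈-cartesianProductWith⁻ _∷_ (allFin n) (allLists Γ k) (subst (_ ∈_) (allLists≡product k) m)
  ... | _ , _ , _ , m′ , refl = cong suc (allLists-length k m′)

  Common : (u x y p : Fin n) → Set
  Common u x y p = p ≢ u × x ∼ p × y ∼ p

  common? : ∀ u x y p → Dec (Common u x y p)
  common? u x y p = ¬? (p ≟ᶠ u) ×-dec ((adj x p ≟ᵇ true) ×-dec (adj y p ≟ᵇ true))

  common : (u x y : Fin n) → List (Fin n)
  common u x y = filter (common? u x y) (allFin n)

  common-unique : ∀ u x y → Unique (common u x y)
  common-unique u x y = filter⁺ (common? u x y) (allFin⁺ n)

  ∈-common⁺ : ∀ {u x y p} → Common u x y p → p ∈ common u x y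
  ∈-common⁺ {u} {x} {y} c = ∈-filter⁺ (common? u x y) (∈-allFin _) c

  ∈-common⁻ : ∀ {u x y p} → p ∈ common u x y → Common u x y p
  ∈-common⁻ {u} {x} {y} m = proj₂ (∈-filter⁻ (common? u x y) {xs = allFin n} m)

  -- The number of 4-cycles through the path x, u, y.
  codeg : (u x y : Fin n) → ℕ
  codeg u x y = length (common u x y)

  codeg-comm : ∀ u x y → codeg u x y ≡ codeg u y x
  codeg-comm u x y = cong length (filter-≐ (common? u x y) (common? u y x) (map₂ swap , map₂ swap) (allFin n))

  Sq⇒1≤ : ∀ {u x y} → Sq u x y → 1 ≤ codeg u x y
  Sq⇒1≤ {u} {x} {y} (p , c) with common u x y | ∈-common⁺ c
  ... | _ ∷ _ | _ = s≤s z≤n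

  1≤⇒Sq : ∀ {u x y} → 1 ≤ codeg u x y → Sq u x y
  1≤⇒Sq {u} {x} {y} le with common u x y in eq
  ... | p ∷ _ = p , ∈-common⁻ (subst (p ∈_) (sym eq) (here refl))

  distinct⇒2≤ : ∀ {u x y p q} → p ≢ q → Common u x y p → Common u x y q → 2 ≤ codeg u x y
  distinct⇒2≤ {u} {x} {y} p≢q c d = unique-⊆⇒length≤ ((p≢q ∷ []) ∷ [] ∷ [])
    λ { (here refl) → ∈-common⁺ c ; (there (here refl)) → ∈-common⁺ d }

  2≤⇒distinct : ∀ {u x y} → 2 ≤ codeg u x y → ∃[ p ] ∃[ q ] (p ≢ q × Common u x y p × Common u x y q)
  2≤⇒distinct {u} {x} {y} le with common u x y in eq | common-unique u x y
  2≤⇒distinct (s≤s ()) | _ ∷ [] | _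
  ... | p ∷ q ∷ _ | (p≢q ∷ _) ∷ _ = p , q , p≢q ,
    ∈-common⁻ (subst (p ∈_) (sym eq) (here refl)) , ∈-common⁻ (subst (q ∈_) (sym eq) (there (here refl)))

-- Counting 4-cycles at a vertex.

module Counting (Γ : SimpleGraph) (cubic : Cubic Γ) where
  open CubicGraph Γ cubic
  open Cycles Γ

  -- Together with `u`, the vertices counted are distinct neighbours of `x`.
  codeg≤2 : ∀ {u x y} → u ∼ x → codeg u x y ≤ 2
  codeg≤2 {u} {x} {y} ux = ≤-pred (≤-trans (unique-⊆⇒length≤ uniq sub) (≤-reflexive (cubic x)))
    where
    uniq : Unique (u ∷ common u x y)
    uniq = All.tabulate (λ m e → proj₁ (∈-common⁻ m) (sym e)) ∷ common-unique u x y
    sub : ∀ {z} → z ∈ u ∷ common u x y → z ∈ neighbours Γ x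
    sub (here refl) = ∈-neighbours⁺ (∼-sym ux)
    sub (there m) = ∈-neighbours⁺ (proj₁ (proj₂ (∈-common⁻ m)))

  -- A 4-cycle through the edge from `u` to `x` returns to `u` through `y` or `z`, and is then fixed
  -- by its fourth vertex, a common neighbour of `x` and that one.
  ε-codeg : ∀ {u x y z} → Nbrs u x y z → ε Γ 4 u x ≡ codeg u x y + codeg u x z
  ε-codeg {u} {x} {y} {z} N = begin
    length cycles                                   ≡⟨ ↭-length (unique-set⇒↭ cycles-unique paths-unique to from) ⟩
    length (via y ++ via z)                         ≡⟨ length-++ (via y) ⟩
    length (via y) + length (via z)                 ≡⟨ cong₂ _+_ (length-map _ (common u x y)) (length-map _ (common u x z)) ⟩
    codeg u x y + codeg u x z                       ∎
    where
    open ≡-Reasoning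
    isCycle? = λ xs → isCycle Γ xs ≟ᵇ true
    candidates cycles : List (List (Fin n))
    candidates = map (λ r → u ∷ x ∷ r) (allLists Γ 2)
    cycles = filter isCycle? candidates
    via : Fin n → List (List (Fin n))
    via q = map (λ p → u ∷ x ∷ p ∷ q ∷ []) (common u x q)

    cycles-unique : Unique cycles
    cycles-unique = filter⁺ isCycle? (map⁺ (∷-injectiveʳ ∘ ∷-injectiveʳ) (allLists-unique 2))

    via-unique : ∀ q → Unique (via q)
    via-unique q = map⁺ (∷-injectiveˡ ∘ ∷-injectiveʳ ∘ ∷-injectiveʳ) (common-unique u x q)

    paths-unique : Unique (via y ++ via z)
    paths-unique = ++⁺ (via-unique y) (via-unique z) disjoint
      where
      disjoint : ∀ {c} → ¬ (c ∈ via y × c ∈ via z)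
      disjoint (my , mz) with ∈-map⁻ _ my | ∈-map⁻ _ mz
      ... | _ , _ , refl | _ , _ , refl = ≢₂₃ N refl

    to : ∀ {c} → c ∈ cycles → c ∈ via y ++ via z
    to m with ∈-filter⁻ isCycle? {xs = candidates} m
    ... | m′ , cyc with ∈-map⁻ _ m′
    ... | r , r∈ , refl with r | allLists-length 2 r∈
    ... | p ∷ q ∷ [] | refl with isCycle₄⁻ cyc
    ... | (_ ∷ up ∷ _ ∷ []) ∷ (_ ∷ xq ∷ []) ∷ _ , ux , xp , pq , qu with complete N (∼-sym qu)
    ... | inj₁ refl = contradiction refl xq
    ... | inj₂ (inj₁ refl) = ∈-++⁺ˡ (∈-map⁺ _ (∈-common⁺ (≢-sym up , xp , ∼-sym pq)))
    ... | inj₂ (inj₂ refl) = ∈-++⁺ʳ (via y) (∈-map⁺ _ (∈-common⁺ (≢-sym up , xp , ∼-sym pq)))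

    from-via : ∀ {q c} → u ∼ q → x ≢ q → c ∈ via q → c ∈ cycles
    from-via {q} uq xq m with ∈-map⁻ _ m
    ... | p , p∈ , refl with ∈-common⁻ p∈
    ... | pu , xp , qp = ∈-filter⁺ isCycle? (∈-map⁺ (λ r → u ∷ x ∷ r) (∈-allLists (p ∷ q ∷ [])))
      (isCycle₄⁺ ((∼⇒≢ (∼₁ N) ∷ ≢-sym pu ∷ ∼⇒≢ uq ∷ []) ∷ (∼⇒≢ xp ∷ xq ∷ []) ∷ (≢-sym (∼⇒≢ qp) ∷ []) ∷ [] ∷ [])
        (∼₁ N) xp (∼-sym qp) (∼-sym uq))

    from : ∀ {c} → c ∈ via y ++ via z → c ∈ cycles
    from m with ∈-++⁻ (via y) m
    ... | inj₁ my = from-via (∼₂ N) (≢₁₂ N) my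
    ... | inj₂ mz = from-via (∼₃ N) (≢₁₃ N) mz

  squares : (u x y z : Fin n) → ℕ
  squares u x y z = codeg u x y + (codeg u y z + codeg u x z)

  -- Each 4-cycle through `u` uses two of the three edges at `u`, so the sum counts it twice.
  signature-sum : ∀ {u x y z} → Nbrs u x y z → sum (signature Γ 4 u) ≡ 2 * squares u x y z
  signature-sum {u} {x} {y} {z} N = begin
    sum (signature Γ 4 u)                           ≡⟨ sum-↭ (↭-map⁺ (ε Γ 4 u) (neighbours-↭ N)) ⟩
    ε Γ 4 u x + (ε Γ 4 u y + (ε Γ 4 u z + 0))       ≡⟨ cong₂ _+_ (ε-codeg N) (cong₂ (λ i j → i + (j + 0)) εy εz) ⟩
    (xy + xz) + ((xy + yz) + ((xz + yz) + 0))       ≡⟨ rearrange xy yz xz ⟩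
    2 * (xy + (yz + xz))                            ∎
    where
    open ≡-Reasoning
    xy = codeg u x y
    yz = codeg u y z
    xz = codeg u x z
    εy : ε Γ 4 u y ≡ xy + yz
    εy = trans (ε-codeg (swap₁₂ N)) (cong (_+ yz) (codeg-comm u y x))
    εz : ε Γ 4 u z ≡ xz + yz
    εz = trans (ε-codeg (rotate (rotate N))) (cong₂ _+_ (codeg-comm u z x) (codeg-comm u z y))
    rearrange : ∀ a b c → (a + c) + ((a + b) + ((c + b) + 0)) ≡ 2 * (a + (b + c))
    rearrange = solve 3 (λ a b c → (a :+ c) :+ ((a :+ b) :+ ((c :+ b) :+ con 0)) := con 2 :* (a :+ (b :+ c))) refl
      where open +-*-Solver

  squares-constant : GirthRegular Γ 4 → ∀ {u x y z u′ x′ y′ z′} →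
    Nbrs u x y z → Nbrs u′ x′ y′ z′ → squares u x y z ≡ squares u′ x′ y′ z′
  squares-constant regular {u} {u′ = u′} N N′ = *-cancelˡ-≡ _ _ 2
    (trans (sym (signature-sum N)) (trans (sum-↭ (regular u u′)) (signature-sum N′)))

-- What girth 4 provides.

module GirthFour (Γ : SimpleGraph) (girth : IsGirth Γ 4) where
  open Graph Γ
  open Squares Γ
  open Cycles Γ

  triangle-free : TriangleFree
  triangle-free {u} {v} {w} uv vw uw = contradiction
    (proj₂ girth (u ∷ v ∷ w ∷ []) (isCycle₃⁺ ((∼⇒≢ uv ∷ ∼⇒≢ uw ∷ []) ∷ (∼⇒≢ vw ∷ []) ∷ [] ∷ []) uv vw (∼-sym uw))) 1+n≰n

  some-square : ∃[ u ] ∃[ x ] ∃[ y ] (u ∼ x × u ∼ y × x ≢ y × Sq u x y)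
  some-square with proj₁ girth
  ... | u ∷ x ∷ p ∷ y ∷ [] , refl , cyc with isCycle₄⁻ cyc
  ... | (_ ∷ up ∷ _ ∷ []) ∷ (_ ∷ xy ∷ []) ∷ _ , ux , xp , py , yu =
    u , x , y , ux , ∼-sym yu , xy , p , ≢-sym up , xp , ∼-sym py

-- The classification by the number of squares at a vertex.

module Classification (Γ : SimpleGraph) (connected : Connected Γ) (cubic : Cubic Γ) where
  open CubicGraph Γ cubic
  open Squares Γ
  open Cycles Γ
  open Counting Γ cubic
  open Recognition Γ connected cubic

  module _ (triangle-free : TriangleFree)
    (k : ℕ) (squares-k : ∀ {u x y z} → Nbrs u x y z → squares u x y z ≡ k) where

    Sq³⇒3≤k : ∀ {u x y z} → Nbrs u x y z → Sq u x y → Sq u y z → Sq u x z → 3 ≤ k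
    Sq³⇒3≤k N s t v = subst (3 ≤_) (squares-k N) (+-mono-≤ (Sq⇒1≤ s) (+-mono-≤ (Sq⇒1≤ t) (Sq⇒1≤ v)))

    module K₃₃ {u p q x y} (X : Nbrs x u p q) (Y : Nbrs y u p q) (x≢y : x ≢ y) where

      -- Counted at `x`: all three of its neighbours are adjacent to `y`, so each pair of them spans
      -- a square.
      3≤k : 3 ≤ k
      3≤k = Sq³⇒3≤k X (y , ≢-sym x≢y , ∼-sym (∼₁ Y) , ∼-sym (∼₂ Y))
        (y , ≢-sym x≢y , ∼-sym (∼₂ Y) , ∼-sym (∼₃ Y)) (y , ≢-sym x≢y , ∼-sym (∼₁ Y) , ∼-sym (∼₃ Y))

      -- The pair `x`, `y` accounts for at most 2 of at least 3 squares, so some square at `u` uses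
      -- `z` and one of `x`, `y`. Its fourth vertex is a neighbour of `x` or `y` other than `u`,
      -- that is, `p` or `q`.
      third-hits : ∀ {z} → Nbrs u x y z → z ∼ p ⊎ z ∼ q
      third-hits {z} N = cases (codeg u y z) (codeg u x z) refl refl
        (≤-trans 3≤k (≤-reflexive (sym (squares-k N))))
        where
        from : ∀ {w t} → Nbrs w u p q → Sq u w t → t ∼ p ⊎ t ∼ q
        from W (v , v≢u , wv , tv) with complete W wv
        ... | inj₁ e = contradiction e v≢u
        ... | inj₂ (inj₁ refl) = inj₁ tv
        ... | inj₂ (inj₂ refl) = inj₂ tv
        cases : ∀ i j → codeg u y z ≡ i → codeg u x z ≡ j → 3 ≤ codeg u x y + (codeg u y z + codeg u x z) →
          z ∼ p ⊎ z ∼ q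
        cases (suc _) _ e _ _ = from Y (1≤⇒Sq (≤-trans (s≤s z≤n) (≤-reflexive (sym e))))
        cases 0 (suc _) _ e _ = from X (1≤⇒Sq (≤-trans (s≤s z≤n) (≤-reflexive (sym e))))
        cases 0 0 e e′ le = contradiction
          (≤-trans le (+-mono-≤ (codeg≤2 (∼₁ N)) (≤-reflexive (cong₂ _+_ e e′)))) 1+n≰n

    K₃₃-≅ : ∀ {u p q x y z} → Nbrs x u p q → Nbrs y u p q → Nbrs z u p q → x ≢ y → x ≢ z → y ≢ z →
      _≅_ Γ (Möbius 3)
    K₃₃-≅ {u} {p} {q} {x} {y} {z} X Y Z x≢y x≢z y≢z =
      -- The hexagon with its long diagonals is the Möbius ladder. For `M` equal to 3 both rung
      -- conditions are cases of `noBack`, since two places after `4 + i` the hexagon is back at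
      -- `i`.
      möbius-≅ 2 a (λ _ → refl) step rung noBack (noBack ∘ suc) (λ i → ≢-sym (noBack (4 + i))) inj
      where
      hexagon : List (Fin n)
      hexagon = u ∷ x ∷ p ∷ y ∷ q ∷ z ∷ []
      hexagon-unique : Unique hexagon
      hexagon-unique =
        (≢-sym (∼⇒≢ (∼₁ X)) ∷ ≢₁₂ X ∷ ≢-sym (∼⇒≢ (∼₁ Y)) ∷ ≢₁₃ X ∷ ≢-sym (∼⇒≢ (∼₁ Z)) ∷ []) ∷
        (∼⇒≢ (∼₂ X) ∷ x≢y ∷ ∼⇒≢ (∼₃ X) ∷ x≢z ∷ []) ∷
        (≢-sym (∼⇒≢ (∼₂ Y)) ∷ ≢₂₃ X ∷ ≢-sym (∼⇒≢ (∼₂ Z)) ∷ []) ∷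
        (∼⇒≢ (∼₃ Y) ∷ y≢z ∷ []) ∷ (≢-sym (∼⇒≢ (∼₃ Z)) ∷ []) ∷ [] ∷ []
      -- The residue modulo 6 by recursion, which makes periodicity definitional.
      position : ℕ → Fin 6
      position 0 = 0F
      position 1 = 1F
      position 2 = 2F
      position 3 = 3F
      position 4 = 4F
      position 5 = 5F
      position (suc (suc (suc (suc (suc (suc i)))))) = position i
      a : ℕ → Fin n
      a i = lookup hexagon (position i)
      toℕ-position : ∀ i → i < 6 → toℕ (position i) ≡ i
      toℕ-position 0 _ = refl
      toℕ-position 1 _ = refl
      toℕ-position 2 _ = refl
      toℕ-position 3 _ = refl
      toℕ-position 4 _ = refl
      toℕ-position 5 _ = refl
      toℕ-position (suc (suc (suc (suc (suc (suc i)))))) (s≤s (s≤s (s≤s (s≤s (s≤s (s≤s ()))))))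
      inj : ∀ {i j} → i < 6 → j < 6 → a i ≡ a j → i ≡ j
      inj {i} {j} i< j< e = trans (sym (toℕ-position i i<))
        (trans (cong toℕ (lookup-injective hexagon-unique e)) (toℕ-position j j<))
      step : ∀ i → a i ∼ a (suc i)
      step 0 = ∼-sym (∼₁ X)
      step 1 = ∼₂ X
      step 2 = ∼-sym (∼₂ Y)
      step 3 = ∼₃ Y
      step 4 = ∼-sym (∼₃ Z)
      step 5 = ∼₁ Z
      step (suc (suc (suc (suc (suc (suc i)))))) = step i
      rung : ∀ i → a i ∼ a (3 + i)
      rung 0 = ∼-sym (∼₁ Y)
      rung 1 = ∼₃ X
      rung 2 = ∼-sym (∼₂ Z)
      rung 3 = ∼₁ Y
      rung 4 = ∼-sym (∼₃ X)
      rung 5 = ∼₂ Z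
      rung (suc (suc (suc (suc (suc (suc i)))))) = rung i
      noBack : ∀ i → a i ≢ a (2 + i)
      noBack 0 = ≢₁₂ X
      noBack 1 = x≢y
      noBack 2 = ≢₂₃ X
      noBack 3 = y≢z
      noBack 4 = ≢-sym (≢₁₃ X)
      noBack 5 = ≢-sym x≢z
      noBack (suc (suc (suc (suc (suc (suc i)))))) = noBack i

    K₂₃⁺⇒K₃₃ : ∀ {u p q x y z} → Nbrs x u p q → Nbrs y u p q → Nbrs u x y z → z ∼ p → _≅_ Γ (Möbius 3)
    K₂₃⁺⇒K₃₃ {u} {p} {q} {x} {y} {z} X Y U zp =
      K₃₃-≅ X Y (mkNbrs (∼-sym (∼₃ U)) zp zq (≢₁₂ X) (≢₁₃ X) (≢₂₃ X)) (≢₁₂ U) (≢₁₃ U) (≢₂₃ U)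
      where
      P : Nbrs p x y z
      P = mkNbrs (∼-sym (∼₂ X)) (∼-sym (∼₂ Y)) (∼-sym zp) (≢₁₂ U) (≢₁₃ U) (≢₂₃ U)
      -- `third-hits` centred at `q`: its third neighbour is adjacent to `u` or `p`, whose
      -- neighbours are `x`, `y`, `z`, so it can only be `z`.
      zq : z ∼ q
      zq with third (∼-sym (∼₃ X)) (∼-sym (∼₃ Y)) (≢₁₂ U)
      ... | z′ , Q with K₃₃.third-hits (rotate (rotate X)) (rotate (rotate Y)) (≢₁₂ U) Q
      ... | inj₁ z′u = subst (_∼ q) (remaining U (∼-sym z′u) (≢-sym (≢₁₃ Q)) (≢-sym (≢₂₃ Q))) (∼-sym (∼₃ Q))
      ... | inj₂ z′p = subst (_∼ q) (remaining P (∼-sym z′p) (≢-sym (≢₁₃ Q)) (≢-sym (≢₂₃ Q))) (∼-sym (∼₃ Q))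

    K₂₃⇒K₃₃ : ∀ {u p q x y} → Nbrs x u p q → Nbrs y u p q → x ≢ y → _≅_ Γ (Möbius 3)
    K₂₃⇒K₃₃ X Y x≢y with third (∼-sym (∼₁ X)) (∼-sym (∼₁ Y)) x≢y
    ... | z , U with K₃₃.third-hits X Y x≢y U
    ... | inj₁ zp = K₂₃⁺⇒K₃₃ X Y U zp
    ... | inj₂ zq = K₂₃⁺⇒K₃₃ (swap₂₃ X) (swap₂₃ Y) U zq

    codeg≥2⇒K₃₃ : ∀ {u x y} → u ∼ x → u ∼ y → x ≢ y → 2 ≤ codeg u x y → _≅_ Γ (Möbius 3)
    codeg≥2⇒K₃₃ ux uy x≢y le with 2≤⇒distinct le
    ... | p , q , p≢q , (p≢u , xp , yp) , (q≢u , xq , yq) = K₂₃⇒K₃₃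
      (mkNbrs (∼-sym ux) xp xq (≢-sym p≢u) (≢-sym q≢u) p≢q)
      (mkNbrs (∼-sym uy) yp yq (≢-sym p≢u) (≢-sym q≢u) p≢q) x≢y

    -- Graphs in which every 2-path lies in at most one square.

    module Thin (codeg≤1 : ∀ {u x y} → u ∼ x → u ∼ y → x ≢ y → codeg u x y ≤ 1) where

      -- The path p, x, q would be completed to a square by both `y` and `z`.
      no-K₂₃ : ∀ {p q x y z} → Nbrs p x y z → p ≢ q → q ∼ x → q ∼ y → q ∼ z → ⊥
      no-K₂₃ N p≢q qx qy qz = 1+n≰n (≤-trans
        (distinct⇒2≤ (≢₂₃ N) (≢-sym (≢₁₂ N) , ∼₂ N , qy) (≢-sym (≢₁₃ N) , ∼₃ N , qz))
        (codeg≤1 (∼-sym (∼₁ N)) (∼-sym qx) p≢q))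

      -- Three summands, each at most 1, can reach 3 only if none vanishes.
      all-Sq : 3 ≤ k → ∀ {u x y} → u ∼ x → u ∼ y → x ≢ y → Sq u x y
      all-Sq 3≤k {u} {x} {y} ux uy x≢y with third ux uy x≢y
      ... | z , N = 1≤⇒Sq (bound (≤-trans 3≤k (≤-reflexive (sym (squares-k N)))))
        where
        bound : 3 ≤ codeg u x y + (codeg u y z + codeg u x z) → 1 ≤ codeg u x y
        bound le with codeg u x y
        ... | suc _ = s≤s z≤n
        ... | zero  = contradiction
          (≤-trans le (+-mono-≤ (codeg≤1 (∼₂ N) (∼₃ N) (≢₂₃ N)) (codeg≤1 (∼₁ N) (∼₃ N) (≢₁₃ N)))) 1+n≰n

      module _ {v x y z a b c w}
        (V : Nbrs v x y z)
        (v≢a : v ≢ a) (xa : x ∼ a) (ya : y ∼ a)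
        (v≢b : v ≢ b) (xb : x ∼ b) (zb : z ∼ b)
        (v≢c : v ≢ c) (yc : y ∼ c) (zc : z ∼ c)
        (x≢w : x ≢ w) (aw : a ∼ w) (bw : b ∼ w) (cw : c ∼ w) where

        private
          z≁a : ¬ z ∼ a
          z≁a za = no-K₂₃ V v≢a (∼-sym xa) (∼-sym ya) (∼-sym za)
          y≁b : ¬ y ∼ b
          y≁b yb = no-K₂₃ V v≢b (∼-sym xb) (∼-sym yb) (∼-sym zb)

          b≢c : b ≢ c
          b≢c e = y≁b (subst (y ∼_) (sym e) yc)
          z≢w : z ≢ w
          z≢w e = z≁a (∼-sym (subst (a ∼_) (sym e) aw))

          -- Two opposite faces in cyclic order, with rungs joining equal positions.
          cube : List (Fin n)
          cube = v ∷ x ∷ a ∷ y ∷ z ∷ b ∷ w ∷ c ∷ []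

          cube-unique : Unique cube
          cube-unique =
            (∼⇒≢ (∼₁ V) ∷ v≢a ∷ ∼⇒≢ (∼₂ V) ∷ ∼⇒≢ (∼₃ V) ∷ v≢b
              ∷ (λ e → triangle-free (∼₁ V) xa (∼-sym (subst (a ∼_) (sym e) aw))) ∷ v≢c ∷ []) ∷
            (∼⇒≢ xa ∷ ≢₁₂ V ∷ ≢₁₃ V ∷ ∼⇒≢ xb ∷ x≢w
              ∷ (λ e → triangle-free (∼₂ V) (subst (y ∼_) (sym e) yc) (∼₁ V)) ∷ []) ∷
            (≢-sym (∼⇒≢ ya) ∷ (λ e → triangle-free (∼₁ V) (subst (x ∼_) e xa) (∼₃ V))
              ∷ (λ e → z≁a (subst (z ∼_) (sym e) zb)) ∷ ∼⇒≢ aw ∷ (λ e → z≁a (subst (z ∼_) (sym e) zc)) ∷ []) ∷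
            (≢₂₃ V ∷ (λ e → triangle-free (∼₁ V) (subst (x ∼_) (sym e) xb) (∼₂ V))
              ∷ (λ e → y≁b (∼-sym (subst (b ∼_) (sym e) bw))) ∷ ∼⇒≢ yc ∷ []) ∷
            (∼⇒≢ zb ∷ z≢w ∷ ∼⇒≢ zc ∷ []) ∷ (∼⇒≢ bw ∷ b≢c ∷ []) ∷ (≢-sym (∼⇒≢ cw) ∷ []) ∷ [] ∷ []

        cube-≅ : _≅_ Γ (Prism 4)
        cube-≅ = prism-≅ 3 f period step rung noBack inj
          where
          position : Bool → ℕ → Fin 8
          position true  0 = 0F
          position true  1 = 1F
          position true  2 = 2F
          position true  3 = 3F
          position false 0 = 4F
          position false 1 = 5F
          position false 2 = 6F
          position false 3 = 7F
          position s (suc (suc (suc (suc i)))) = position s i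
          f : Bool → ℕ → Fin n
          f s i = lookup cube (position s i)
          coordinates : Fin 8 → Bool × ℕ
          coordinates 0F = true , 0
          coordinates 1F = true , 1
          coordinates 2F = true , 2
          coordinates 3F = true , 3
          coordinates 4F = false , 0
          coordinates 5F = false , 1
          coordinates 6F = false , 2
          coordinates 7F = false , 3
          coordinates-position : ∀ s i → i < 4 → coordinates (position s i) ≡ (s , i)
          coordinates-position true  0 _ = refl
          coordinates-position true  1 _ = refl
          coordinates-position true  2 _ = refl
          coordinates-position true  3 _ = refl
          coordinates-position false 0 _ = refl
          coordinates-position false 1 _ = refl
          coordinates-position false 2 _ = refl
          coordinates-position false 3 _ = refl
          coordinates-position _ (suc (suc (suc (suc i)))) (s≤s (s≤s (s≤s (s≤s ()))))
          inj : ∀ {s t i j} → i < 4 → j < 4 → f s i ≡ f t j → s ≡ t × i ≡ j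
          inj {s} {t} {i} {j} i< j< e = cong proj₁ same , cong proj₂ same
            where
            same : (s , i) ≡ (t , j)
            same = trans (sym (coordinates-position s i i<))
              (trans (cong coordinates (lookup-injective cube-unique e)) (coordinates-position t j j<))
          period : ∀ s i → f s (4 + i) ≡ f s i
          period true  i = refl
          period false i = refl
          step : ∀ s i → f s i ∼ f s (suc i)
          step true  0 = ∼₁ V
          step true  1 = xa
          step true  2 = ∼-sym ya
          step true  3 = ∼-sym (∼₂ V)
          step false 0 = zb
          step false 1 = bw
          step false 2 = ∼-sym cw
          step false 3 = ∼-sym zc
          step true  (suc (suc (suc (suc i)))) = step true i
          step false (suc (suc (suc (suc i)))) = step false i
          rung : ∀ i → f true i ∼ f false i
          rung 0 = ∼₃ V
          rung 1 = xb
          rung 2 = aw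
          rung 3 = yc
          rung (suc (suc (suc (suc i)))) = rung i
          noBack : ∀ s i → f s i ≢ f s (2 + i)
          noBack true  0 = v≢a
          noBack true  1 = ≢₁₂ V
          noBack true  2 = ≢-sym v≢a
          noBack true  3 = ≢-sym (≢₁₂ V)
          noBack false 0 = z≢w
          noBack false 1 = b≢c
          noBack false 2 = ≢-sym z≢w
          noBack false 3 = ≢-sym b≢c
          noBack true  (suc (suc (suc (suc i)))) = noBack true i
          noBack false (suc (suc (suc (suc i)))) = noBack false i

      -- The squares at `v` give `a`, `b`, `c`. The paths a, x, b and a, y, c then have fourth
      -- vertices `w` and `w′`, and both are the third neighbour of `a`, which closes the cube.
      cube-case : 3 ≤ k → Fin n → _≅_ Γ (Prism 4)
      cube-case 3≤k v with nbrs v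
      ... | x , y , z , V
        with all-Sq 3≤k (∼₁ V) (∼₂ V) (≢₁₂ V) | all-Sq 3≤k (∼₁ V) (∼₃ V) (≢₁₃ V) | all-Sq 3≤k (∼₂ V) (∼₃ V) (≢₂₃ V)
      ... | a , a≢v , xa , ya | b , b≢v , xb , zb | c , c≢v , yc , zc
        with all-Sq 3≤k xa xb (λ { refl → no-K₂₃ V (≢-sym a≢v) (∼-sym xa) (∼-sym ya) (∼-sym zb) })
           | all-Sq 3≤k ya yc (λ { refl → no-K₂₃ V (≢-sym a≢v) (∼-sym xa) (∼-sym ya) (∼-sym zc) })
      ... | w , w≢x , aw , bw | w′ , w′≢y , aw′ , cw′ =
        cube-≅ V (≢-sym a≢v) xa ya (≢-sym b≢v) xb zb (≢-sym c≢v) yc zc (≢-sym w≢x) aw bw (subst (c ∼_) w′≡w cw′)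
        where
        A : Nbrs a x y w
        A = mkNbrs (∼-sym xa) (∼-sym ya) aw (≢₁₂ V) (≢-sym w≢x)
          (λ { refl → no-K₂₃ V (≢-sym b≢v) (∼-sym xb) bw (∼-sym zb) })
        w′≡w : w′ ≡ w
        w′≡w = remaining A aw′ (λ { refl → no-K₂₃ V (≢-sym c≢v) cw′ (∼-sym yc) (∼-sym zc) }) w′≢y

      -- The edge lies in a square with each other edge at `u`; quantifying over `x` avoids ordering
      -- those two edges.
      record Rung (u r : Fin n) : Set where
        constructor mkRung
        field
          adjacent : u ∼ r
          sides    : ∀ {x} → u ∼ x → x ≢ r → Sq u x r

      open Rung

      rung : ∀ {u r x y} → Nbrs u r x y → Sq u x r → Sq u y r → Rung u r
      rung {u} {r} N sx sy = mkRung (∼₁ N) sides′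
        where
        sides′ : ∀ {t} → u ∼ t → t ≢ r → Sq u t r
        sides′ ut t≢r with complete N ut
        ... | inj₁ e = contradiction e t≢r
        ... | inj₂ (inj₁ refl) = sx
        ... | inj₂ (inj₂ refl) = sy

      -- The two squares on the edge reach `r` through `p` and `q`. These differ, as otherwise a
      -- K₂,₃ appears, so they are the other neighbours of `r`.
      rung-sym : ∀ {u r} → Rung u r → Rung r u
      rung-sym R with others (adjacent R)
      ... | s , t , M with sides R (∼₂ M) (≢-sym (≢₁₂ M)) | sides R (∼₃ M) (≢-sym (≢₁₃ M))
      ... | p , p≢u , sp , rp | q , q≢u , tq , rq =
        rung (mkNbrs (∼-sym (∼₁ M)) rp rq (≢-sym p≢u) (≢-sym q≢u)
               (λ { refl → no-K₂₃ M (≢-sym p≢u) (∼-sym rp) (∼-sym sp) (∼-sym tq) }))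
          (s , ≢-sym (≢₁₂ M) , ∼-sym sp , ∼₂ M) (t , ≢-sym (≢₁₃ M) , ∼-sym tq , ∼₃ M)

      -- Two squares at each vertex: the rung involution.

      module _ (k≡2 : k ≡ 2) where

        three-Sq-absurd : ∀ {u x y z} → Nbrs u x y z → Sq u x y → Sq u y z → Sq u x z → ⊥
        three-Sq-absurd N s t v = 1+n≰n (≤-trans (Sq³⇒3≤k N s t v) (≤-reflexive k≡2))

        -- Two different rungs at `u` would put all three pairs of its neighbours on squares.
        rung-unique : ∀ {u r r′} → Rung u r → Rung u r′ → r ≡ r′
        rung-unique {u} {r} {r′} R R′ with r ≟ᶠ r′
        ... | yes e = e
        ... | no r≢r′ with third (adjacent R) (adjacent R′) r≢r′
        ... | t , N = ⊥-elim (three-Sq-absurd N (sides R′ (∼₁ N) (≢₁₂ N))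
          (Sq-sym (sides R′ (∼₃ N) (≢-sym (≢₂₃ N)))) (Sq-sym (sides R (∼₃ N) (≢-sym (≢₁₃ N)))))

        -- Three summands, each at most 1, add up to 2, so two pairs lie on squares; the neighbour
        -- common to these pairs is the rung mate.
        rung-exists : ∀ u → ∃[ r ] Rung u r
        rung-exists u with nbrs u
        ... | x , y , z , N = cases
          (codeg≤1 (∼₁ N) (∼₂ N) (≢₁₂ N)) (codeg≤1 (∼₂ N) (∼₃ N) (≢₂₃ N)) (codeg≤1 (∼₁ N) (∼₃ N) (≢₁₃ N))
          1≤⇒Sq 1≤⇒Sq 1≤⇒Sq (trans (squares-k N) k≡2)
          where
          cases : ∀ {i j l} → i ≤ 1 → j ≤ 1 → l ≤ 1 →
            (1 ≤ i → Sq u x y) → (1 ≤ j → Sq u y z) → (1 ≤ l → Sq u x z) → i + (j + l) ≡ 2 → ∃[ r ] Rung u r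
          cases (s≤s z≤n) (s≤s z≤n) _ xy yz xz _ =
            y , rung (rotate N) (Sq-sym (yz (s≤s z≤n))) (xy (s≤s z≤n))
          cases (s≤s z≤n) z≤n (s≤s z≤n) xy yz xz _ =
            x , rung N (Sq-sym (xy (s≤s z≤n))) (Sq-sym (xz (s≤s z≤n)))
          cases z≤n (s≤s z≤n) (s≤s z≤n) xy yz xz _ =
            z , rung (rotate (rotate N)) (xz (s≤s z≤n)) (yz (s≤s z≤n))
          cases z≤n z≤n z≤n _ _ _ ()
          cases z≤n z≤n (s≤s z≤n) _ _ _ ()
          cases z≤n (s≤s z≤n) z≤n _ _ _ ()

        ρ : Fin n → Fin n
        ρ u = proj₁ (rung-exists u)

        ρ-rung : ∀ u → Rung u (ρ u)
        ρ-rung u = proj₂ (rung-exists u)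

        ρ-involutive : ∀ u → ρ (ρ u) ≡ u
        ρ-involutive u = rung-unique (ρ-rung (ρ u)) (rung-sym (ρ-rung u))

        -- The path v, u, ρ u lies in a square with fourth vertex `w`, which must be `ρ v`. If `ρ v`
        -- were `u`, then `v` would be the mate of `u`; if it were the third neighbour of `v`, all
        -- three pairs at `v` would lie on squares.
        ρ-pres : ∀ {u v} → u ∼ v → v ≢ ρ u → ρ u ∼ ρ v
        ρ-pres {u} {v} uv v≢ρu with sides (ρ-rung u) uv v≢ρu
        ... | w , w≢u , vw , rw with third (∼-sym uv) vw (≢-sym w≢u)
        ... | t , N with complete N (adjacent (ρ-rung v))
        ... | inj₂ (inj₁ e) = subst (ρ u ∼_) (sym e) rw
        ... | inj₁ e = contradiction (rung-unique (rung-sym (subst (Rung v) e (ρ-rung v))) (ρ-rung u)) v≢ρu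
        ... | inj₂ (inj₂ e) = ⊥-elim (three-Sq-absurd N
          (ρ u , ≢-sym v≢ρu , adjacent (ρ-rung u) , ∼-sym rw)
          (sides R (∼₂ N) (≢₂₃ N)) (sides R (∼₁ N) (≢₁₃ N)))
          where
          R : Rung v t
          R = subst (Rung v) e (ρ-rung v)

        ladder-case : Fin n → (Σ ℕ λ m → 3 ≤ m × _≅_ Γ (Möbius m)) ⊎ (Σ ℕ λ m → 4 ≤ m × _≅_ Γ (Prism m))
        ladder-case = Ladder.ladder Γ connected cubic triangle-free ρ (λ u → adjacent (ρ-rung u)) ρ-involutive ρ-pres

    -- One square at each vertex, and the final case split.

    unique-square : k ≡ 1 → ∀ u → ∃[ l ] ∃[ r ] ∃[ m ] (Nbrs u l r m × Sq u l r × ¬ Sq u l m × ¬ Sq u r m)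
    unique-square k≡1 u with nbrs u
    ... | x , y , z , N = cases 1≤⇒Sq 1≤⇒Sq 1≤⇒Sq Sq⇒1≤ Sq⇒1≤ Sq⇒1≤ (trans (squares-k N) k≡1)
      where
      absurd : ∀ {A : Set} → (A → 1 ≤ 0) → ¬ A
      absurd f a with () ← f a
      cases : ∀ {i j l} →
        (1 ≤ i → Sq u x y) → (1 ≤ j → Sq u y z) → (1 ≤ l → Sq u x z) →
        (Sq u x y → 1 ≤ i) → (Sq u y z → 1 ≤ j) → (Sq u x z → 1 ≤ l) → i + (j + l) ≡ 1 →
        ∃[ l ] ∃[ r ] ∃[ m ] (Nbrs u l r m × Sq u l r × ¬ Sq u l m × ¬ Sq u r m)
      cases {1} {0} {0} xy _ _ _ ¬yz ¬xz _ = x , y , z , N , xy (s≤s z≤n) , absurd ¬xz , absurd ¬yz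
      cases {0} {1} {0} _ yz _ ¬xy _ ¬xz _ =
        y , z , x , rotate N , yz (s≤s z≤n) , absurd (¬xy ∘ Sq-sym) , absurd (¬xz ∘ Sq-sym)
      cases {0} {0} {1} _ _ xz ¬xy ¬yz _ _ =
        x , z , y , swap₂₃ N , xz (s≤s z≤n) , absurd ¬xy , absurd (¬yz ∘ Sq-sym)

    truncation-case : k ≡ 1 → Σ MultiGraph λ Λ → MultiGraph.Tetravalent Λ
      × Σ (MultiGraph.DihedralScheme Λ) λ D → _≅_ Γ (MultiGraph.Tr Λ D)
    truncation-case k≡1 = Truncation.truncation Γ cubic (unique-square k≡1)

    -- Finite search decides whether some 2-path lies in two squares, so the case split is
    -- constructive.
    thick? : Dec (∃[ u ] ∃[ x ] ∃[ y ] (u ∼ x × u ∼ y × x ≢ y × 2 ≤ codeg u x y))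
    thick? = any? λ u → any? λ x → any? λ y →
      (adj u x ≟ᵇ true) ×-dec (adj u y ≟ᵇ true) ×-dec ¬? (x ≟ᶠ y) ×-dec (2 ≤? codeg u x y)

    Conclusion : Set
    Conclusion =
      (Σ ℕ λ n → 3 ≤ n × _≅_ Γ (Möbius n))
      ⊎ (Σ ℕ λ n → 4 ≤ n × _≅_ Γ (Prism n))
      ⊎ (Σ MultiGraph λ Λ → MultiGraph.Tetravalent Λ
           × Σ (MultiGraph.DihedralScheme Λ) λ D → _≅_ Γ (MultiGraph.Tr Λ D))

    -- The number `j` stands in for the fixed parameter `k`, so that its value can be matched on.
    classify-thin : (∀ {u x y} → u ∼ x → u ∼ y → x ≢ y → codeg u x y ≤ 1) →
      Fin n → ∀ j → k ≡ j → 1 ≤ j → Conclusion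
    classify-thin thin v 1 k≡1 _ = inj₂ (inj₂ (truncation-case k≡1))
    classify-thin thin v 2 k≡2 _ = assocʳ (inj₁ (Thin.ladder-case thin k≡2 v))
    classify-thin thin v (suc (suc (suc j))) k≡ _ = inj₂ (inj₁ (4 , s≤s (s≤s (s≤s (s≤s z≤n))) ,
      Thin.cube-case thin (≤-trans (s≤s (s≤s (s≤s z≤n))) (≤-reflexive (sym k≡))) v))

    classify : Fin n → 1 ≤ k → Conclusion
    classify v 1≤k = cases thick?
      where
      cases : Dec _ → Conclusion
      cases (yes (u , x , y , ux , uy , x≢y , le)) =
        inj₁ (3 , s≤s (s≤s (s≤s z≤n)) , codeg≥2⇒K₃₃ ux uy x≢y le)
      cases (no thin) = classify-thin
        (λ {u} {x} {y} ux uy x≢y → ≤-pred (≰⇒> λ le → thin (u , x , y , ux , uy , x≢y , le))) v k refl 1≤k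

theorem4p2 : (Γ : SimpleGraph) → Connected Γ → Cubic Γ → IsGirth Γ 4 → GirthRegular Γ 4 →
    (Σ ℕ λ n → 3 ≤ n × _≅_ Γ (Möbius n))
    ⊎ (Σ ℕ λ n → 4 ≤ n × _≅_ Γ (Prism n))
    ⊎ (Σ MultiGraph λ Λ → MultiGraph.Tetravalent Λ
    × Σ (MultiGraph.DihedralScheme Λ) λ D → _≅_ Γ (MultiGraph.Tr Λ D))
theorem4p2 Γ connected cubic girth regular =
  let
      open CubicGraph Γ cubic
      open Cycles Γ
      open Counting Γ cubic
      open GirthFour Γ girth
      -- A girth cycle supplies a base vertex lying on a square; the value of `squares` there is the
      -- common `k`, hence positive.
      u , x , y , u∼x , u∼y , x≢y , square = some-square
      z , N = third u∼x u∼y x≢y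
  in Classification.classify Γ connected cubic triangle-free (squares u x y z)
       (λ N′ → squares-constant regular N′ N) u (≤-trans (Sq⇒1≤ square) (m≤m+n _ _))
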